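{- Let $G$ be a triangle-free graph of order $n$. Then $\phi(G)\le 6^{n/4}$. Furthermore, $\phi(G)=6^{n/4}$ if and only if $n\equiv 0\pmod 4$ and $G$ is isomorphic to the disjoint union of $n/4$ copies of the cycle $C_4$.
   Context: All graphs are finite, simple, undirected and labeled. A subset of vertices $F$ of a graph $G$ is a dissociation set if the induced subgraph $G[F]$ has maximum degree at most $1$. A maximal dissociation set is a dissociation set that is not a proper subset of any other dissociation set. $\phi(G)$ denotes the number of maximal dissociation sets of $G$. -}

module Defs where

open import Data.Bool using (Bool; true; false; T; if_then_else_; _∧_)
open import Data.Nat using (ℕ; zero; suc; _+_; _*_; _≤_; _≤?_)
open import Data.Fin using (Fin; zero; suc; splitAt)
open import Data.Fin.Subset using (Subset; inside; outside; _∈_; _∉_; _⊂_)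
open import Data.Fin.Subset.Properties using (_∈?_; _⊂?_; anySubset?)
open import Data.Fin.Properties using (all?)
open import Data.Vec using (_∷_; [])
open import Data.Sum using (inj₁; inj₂)
open import Data.Product using (_×_; ∃-syntax; _,_)
open import Data.Empty using (⊥)
open import Function using (_∘_)
open import Function.Bundles using (_⤖_; Bijection)
open import Relation.Nullary using (¬_; Dec; yes; no; ¬?; does)
open import Relation.Nullary.Decidable using (_×-dec_; _→-dec_)
open import Relation.Unary using (Pred; Decidable)
open import Relation.Binary.PropositionalEquality using (_≡_; refl)
open import Level using (Level)

record Graph (n : ℕ) : Set where
  field
    E     : Fin n → Fin n → Bool
    sym   : ∀ u v → E u v ≡ E v u
    irrefl : ∀ v → E v v ≡ false
open Graph public

Adj : ∀ {n} → Graph n → Fin n → Fin n → Set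
Adj G u v = T (E G u v)

countFin : ∀ {n} → (Fin n → Bool) → ℕ
countFin {zero}  p = 0
countFin {suc n} p = (if p zero then 1 else 0) + countFin (p ∘ suc)

degIn : ∀ {n} → Graph n → Subset n → Fin n → ℕ
degIn G S v = countFin (λ u → E G v u ∧ does (u ∈? S))

IsDissociation : ∀ {n} → Graph n → Subset n → Set
IsDissociation G F = ∀ v → v ∈ F → degIn G F v ≤ 1

IsMaximalDissociation : ∀ {n} → Graph n → Subset n → Set
IsMaximalDissociation G F =
  IsDissociation G F × ¬ (∃[ F' ] (IsDissociation G F' × F ⊂ F'))

isDissociation? : ∀ {n} (G : Graph n) → Decidable (IsDissociation G)
isDissociation? G F = all? (λ v → (v ∈? F) →-dec (degIn G F v ≤? 1))

isMaximalDissociation? : ∀ {n} (G : Graph n) → Decidable (IsMaximalDissociation G)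
isMaximalDissociation? G F =
  isDissociation? G F ×-dec ¬? (anySubset? (λ F' → isDissociation? G F' ×-dec (F ⊂? F')))

countSubsets : ∀ {ℓ} {n} {P : Pred (Subset n) ℓ} → Decidable P → ℕ
countSubsets {n = zero}  P? with P? []
... | yes _ = 1
... | no  _ = 0
countSubsets {n = suc n} P? =
  countSubsets (P? ∘ (inside ∷_)) + countSubsets (P? ∘ (outside ∷_))

φ : ∀ {n} → Graph n → ℕ
φ G = countSubsets (isMaximalDissociation? G)

TriangleFree : ∀ {n} → Graph n → Set
TriangleFree G = ∀ u v w → ¬ (Adj G u v × Adj G v w × Adj G u w)

record _≅_ {n m : ℕ} (G : Graph n) (H : Graph m) : Set where
  field
    bij      : Fin n ⤖ Fin m
    preserve : ∀ u v → E G u v ≡ E H (Bijection.to bij u) (Bijection.to bij v)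

c4E : Fin 4 → Fin 4 → Bool
c4E zero (suc zero) = true
c4E (suc zero) zero = true
c4E (suc zero) (suc (suc zero)) = true
c4E (suc (suc zero)) (suc zero) = true
c4E (suc (suc zero)) (suc (suc (suc zero))) = true
c4E (suc (suc (suc zero))) (suc (suc zero)) = true
c4E (suc (suc (suc zero))) zero = true
c4E zero (suc (suc (suc zero))) = true
c4E _ _ = false

C4 : Graph 4
C4 = record { E = c4E ; sym = s ; irrefl = i }
  where
    s : ∀ u v → c4E u v ≡ c4E v u
    s zero zero = refl
    s zero (suc zero) = refl
    s zero (suc (suc zero)) = refl
    s zero (suc (suc (suc zero))) = refl
    s (suc zero) zero = refl
    s (suc zero) (suc zero) = refl
    s (suc zero) (suc (suc zero)) = refl
    s (suc zero) (suc (suc (suc zero))) = refl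
    s (suc (suc zero)) zero = refl
    s (suc (suc zero)) (suc zero) = refl
    s (suc (suc zero)) (suc (suc zero)) = refl
    s (suc (suc zero)) (suc (suc (suc zero))) = refl
    s (suc (suc (suc zero))) zero = refl
    s (suc (suc (suc zero))) (suc zero) = refl
    s (suc (suc (suc zero))) (suc (suc zero)) = refl
    s (suc (suc (suc zero))) (suc (suc (suc zero))) = refl
    i : ∀ v → c4E v v ≡ false
    i zero = refl
    i (suc zero) = refl
    i (suc (suc zero)) = refl
    i (suc (suc (suc zero))) = refl

unionE : ∀ {n m} → Graph n → Graph m → Fin (n + m) → Fin (n + m) → Bool
unionE {n} G H u v with splitAt n u | splitAt n v
... | inj₁ a | inj₁ b = E G a b
... | inj₂ a | inj₂ b = E H a b
... | inj₁ _ | inj₂ _ = false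
... | inj₂ _ | inj₁ _ = false

_⊕_ : ∀ {n m} → Graph n → Graph m → Graph (n + m)
_⊕_ {n} G H = record { E = unionE G H ; sym = s ; irrefl = i }
  where
    s : ∀ u v → unionE G H u v ≡ unionE G H v u
    s u v with splitAt n u | splitAt n v
    ... | inj₁ a | inj₁ b = sym G a b
    ... | inj₂ a | inj₂ b = sym H a b
    ... | inj₁ _ | inj₂ _ = refl
    ... | inj₂ _ | inj₁ _ = refl
    i : ∀ v → unionE G H v v ≡ false
    i v with splitAt n v
    ... | inj₁ a = irrefl G a
    ... | inj₂ a = irrefl H a

C4s : (k : ℕ) → Graph (k * 4)
C4s zero    = record { E = λ () ; sym = λ () ; irrefl = λ () }
C4s (suc k) = C4 ⊕ C4s k

{-# OPTIONS --safe #-}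
module Submission where

-- Only the number of maximal dissociation sets of induced subgraphs G[U] is estimated, relative to α^|U| with
-- α = 6^(1/4). Fixing whether a vertex x is absent, isolated, or matched to a neighbour y gives
--   φ(U) ≤ φ(U − x) + φ(U − N[x]) + Σ_{y ∈ N(x)} φ(U − N(x) − N(y)),
-- where N(x) and N(y) are disjoint because there are no triangles; at a leaf y with neighbour z the same reasoning gives
--   φ(U) ≤ φ(U − N[y]) + Σ_{w ∈ N(z)} φ(U − N(z) − N(w)).
-- If some vertex has degree at most one, the second inequality yields φ(U) ≤ 0.8358 α^|U|, and more such vertices
-- improve the constant. Using this for U − x whenever x has a neighbour of degree two, the first inequality yields
-- φ(U) ≤ 0.999 α^|U| unless G[U] is empty or has a component C4, and splitting off such a component costs exactly 6.

open import Defs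
open import Data.Nat using (ℕ; zero; suc; _+_; _*_; _^_; _≤_; _<_; z≤n; s≤s; _≤?_; _/_; NonZero; >-nonZero⁻¹)
open import Data.Nat.Properties
open import Data.Nat.Divisibility using (_∣_; divides)
open import Data.Nat.DivMod using (m*n/n≡m)
open import Data.Nat.ListAction using (sum)
open import Data.Nat.Tactic.RingSolver using (solve-∀)
open import Data.Bool using (Bool; true; false; T; if_then_else_; _∧_)
open import Data.Bool.Properties using (T?)
import Data.Bool.Properties as Bool
open import Data.Empty using (⊥; ⊥-elim)
open import Data.Fin using (Fin; zero; suc; splitAt; join; _↑ˡ_; _↑ʳ_)
open import Data.Fin.Properties using (any?; splitAt-join; join-splitAt; splitAt-↑ˡ; splitAt-↑ʳ; ↑ˡ-injective; ↑ʳ-injective) renaming (_≟_ to _≟ᶠ_; suc-injective to suc-injectiveᶠ)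
open import Data.Fin.Permutation using (↔⇒≡)
open import Data.Fin.Subset using (Subset; inside; outside; _∈_; _∉_; _⊆_; _∩_; _∪_; _-_; ⁅_⁆; ∣_∣; ⊤) renaming (⊥ to ∅)
open import Data.Fin.Subset.Properties
open import Data.List using (List; []; _∷_; _++_; length; map; foldr; filter; allFin; cartesianProductWith)
open import Data.List.Properties using (length-++; length-map)
open import Data.List.Membership.Propositional using (find) renaming (_∈_ to _∈ˡ_; _∉_ to _∉ˡ_)
open import Data.List.Membership.Propositional.Properties
  using (∈-++⁺ˡ; ∈-++⁺ʳ; ∈-++⁻; ∈-∃++; ∈-map⁺; ∈-map⁻; ∈-filter⁺; ∈-filter⁻; ∈-allFin; ∈-cartesianProductWith⁻)
open import Data.List.Relation.Unary.All as All using (All; []; _∷_)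
open import Data.List.Relation.Unary.AllPairs as AllPairs using ([]; _∷_)
open import Data.List.Relation.Unary.Any as Any using (here; there)
open import Data.List.Relation.Unary.Unique.Propositional using (Unique)
import Data.List.Relation.Unary.Unique.Propositional.Properties as Unique
open import Data.Product using (_×_; _,_; proj₁; proj₂; ∃-syntax)
open import Data.Sum using (_⊎_; inj₁; inj₂; [_,_]′)
open import Data.Vec as Vec using ([]; _∷_; here; there; lookup; tabulate)
import Data.Vec.Properties as Vec
open import Function using (_∘_)
open import Function.Bundles using (_⇔_; mk⇔; _↔_; mk↔ₛ′; Inverse; Equivalence)
open import Function.Properties.Bijection using (⤖⇒↔)
open import Function.Properties.Inverse using (↔⇒⤖)
open import Relation.Binary.PropositionalEquality using (_≡_; _≢_; refl; cong; cong₂; subst; trans; module ≡-Reasoning) renaming (sym to ≡-sym)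
open import Relation.Nullary using (¬_; Dec; yes; no; does; ¬?)
open import Relation.Nullary.Decidable using (_×-dec_; True; toWitness)
open import Relation.Unary using (Decidable)
open import Level using (Level)

-- Covering lists and their sizes

-- With only the trivial bound for smaller sets, the plain inequalities are too weak: in a cubic
-- graph they give 0.63894 + 0.16667 + 3 · 0.06804, about 1.0097, and along a cycle α^(-1) + α^(-3)
-- + 2α^(-4), about 1.2331. What helps is that deletions leave vertices of small degree behind, and
-- a set with such vertices has a constant well below 1. Hence the chain `low-cover`, `low-cover₂`,
-- `low-cover₃`, `mixed-cover`, where each constant is obtained from the earlier ones. Since α is
-- irrational, all comparisons are between fourth powers of natural numbers, with slack left for
-- rounding. Counts are bounded by lists that contain every maximal set and may repeat or contain
-- others. A case distinction is then a concatenation, and no disjointness of cases has to be shown.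
-- The equality case needs no second count. Every situation except a component C4 loses a fixed
-- factor, and a C4 contributes exactly 6 = α^4, so a loss that occurs anywhere survives the
-- splitting off of components.

length-mono-⊆ : ∀ {A : Set} {xs ys : List A} → Unique xs → (∀ {x} → x ∈ˡ xs → x ∈ˡ ys) → length xs ≤ length ys
length-mono-⊆ [] _ = z≤n
length-mono-⊆ {xs = x ∷ xs} {ys} (x∉xs ∷ u) sub with ∈-∃++ (sub (here refl))
... | as , bs , refl = begin
  suc (length xs)               ≤⟨ s≤s (length-mono-⊆ u sub′) ⟩
  suc (length (as ++ bs))       ≡⟨ cong suc (length-++ as) ⟩
  suc (length as + length bs)   ≡⟨ +-suc (length as) (length bs) ⟨
  length as + suc (length bs)   ≡⟨ length-++ as ⟨
  length (as ++ x ∷ bs)         ∎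
  where
  open ≤-Reasoning
  sub′ : ∀ {z} → z ∈ˡ xs → z ∈ˡ as ++ bs
  sub′ {z} z∈ with ∈-++⁻ as (sub (there z∈))
  ... | inj₁ p = ∈-++⁺ˡ p
  ... | inj₂ (here refl) = ⊥-elim (All.lookup x∉xs z∈ refl)
  ... | inj₂ (there p) = ∈-++⁺ʳ as p

evaluated : ∀ {a b} {_ : True (a ≤? b)} → a ≤ b
evaluated {_} {_} {p} = toWitness p

^4≤0⇒≡0 : ∀ b s .{{_ : NonZero s}} → b ^ 4 * s ≤ 0 → b ≡ 0
^4≤0⇒≡0 b s le with m*n≡0⇒m≡0∨n≡0 (b ^ 4) (n≤0⇒n≡0 le)
... | inj₁ p = m^n≡0⇒m≡0 b 4 p
... | inj₂ refl = ⊥-elim (<-irrefl refl (>-nonZero⁻¹ 0))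

^4-* : ∀ a b → (a * b) ^ 4 ≡ a ^ 4 * b ^ 4
^4-* = expanded
  where
  expanded : ∀ a b → a * b * (a * b * (a * b * (a * b * 1))) ≡ a * (a * (a * (a * 1))) * (b * (b * (b * (b * 1))))
  expanded = solve-∀

private
  -- the case in which the second summand has the larger ratio b / e
  scaled-+-aux : ∀ a b c e s t .{{_ : NonZero s}} → b ^ 4 * s ≤ e ^ 4 * t → a ^ 4 * s ≤ c ^ 4 * t →
    a * e ≤ b * c → (a + b) ^ 4 * s ≤ (c + e) ^ 4 * t
  -- No ratio b / e exists for `e = 0`, but then `b = 0` and only the first summands remain.
  scaled-+-aux a b c zero s t hb ha le with ^4≤0⇒≡0 b s hb
  ... | refl rewrite +-identityʳ a | +-identityʳ c = ha
  scaled-+-aux a b c e@(suc _) s t hb ha le = *-cancelˡ-≤ (e ^ 4) (begin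
    e ^ 4 * ((a + b) ^ 4 * s)     ≡⟨ *-assoc (e ^ 4) ((a + b) ^ 4) s ⟨
    e ^ 4 * (a + b) ^ 4 * s       ≡⟨ cong (_* s) (^4-* e (a + b)) ⟨
    (e * (a + b)) ^ 4 * s         ≤⟨ *-monoˡ-≤ s (^-monoˡ-≤ 4 le′) ⟩
    (b * (c + e)) ^ 4 * s         ≡⟨ cong (_* s) (^4-* b (c + e)) ⟩
    b ^ 4 * (c + e) ^ 4 * s       ≡⟨ rot (b ^ 4) ((c + e) ^ 4) s ⟩
    (c + e) ^ 4 * (b ^ 4 * s)     ≤⟨ *-monoʳ-≤ ((c + e) ^ 4) hb ⟩
    (c + e) ^ 4 * (e ^ 4 * t)     ≡⟨ rot′ ((c + e) ^ 4) (e ^ 4) t ⟩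
    e ^ 4 * ((c + e) ^ 4 * t)     ∎)
    where
    open ≤-Reasoning
    rot : ∀ x y z → x * y * z ≡ y * (x * z)
    rot = solve-∀
    rot′ : ∀ x y z → x * (y * z) ≡ y * (x * z)
    rot′ = solve-∀
    le′ : e * (a + b) ≤ b * (c + e)
    le′ = begin
      e * (a + b)     ≡⟨ *-distribˡ-+ e a b ⟩
      e * a + e * b   ≤⟨ +-monoˡ-≤ (e * b) (≤-trans (≤-reflexive (*-comm e a)) le) ⟩
      b * c + e * b   ≡⟨ cong (b * c +_) (*-comm e b) ⟩
      b * c + b * e   ≡⟨ *-distribˡ-+ b c e ⟨
      b * (c + e)     ∎

-- The ratios a / c and b / e are both at most (t / s)^(1/4), and the mediant (a + b) / (c + e)
-- never exceeds the larger of them. Comparing a · e with b · c tells which one is larger.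
scaled-+ : ∀ a b c e s t .{{_ : NonZero s}} → a ^ 4 * s ≤ c ^ 4 * t → b ^ 4 * s ≤ e ^ 4 * t →
  (a + b) ^ 4 * s ≤ (c + e) ^ 4 * t
scaled-+ a b c e s t ha hb with ≤-total (a * e) (b * c)
... | inj₁ le = scaled-+-aux a b c e s t hb ha le
... | inj₂ ge rewrite +-comm a b | +-comm c e = scaled-+-aux b a e c s t ha hb ge

6^-nonZero : ∀ {k} → NonZero (6 ^ k)
6^-nonZero {k} = m^n≢0 6 k

-- The denominator stays a variable here, so that nothing in the general calculus of coverings
-- computes with its value.
module Bounds (D : ℕ) where

  private
    swap-last : ∀ x y z → x * y * z ≡ x * z * y
    swap-last = solve-∀

  -- A list of m elements, m ≤ (c / D) · 6^((k − j) / 4), containing everything that satisfies P.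
  record Covered {A : Set} (P : A → Set) (c j k : ℕ) : Set where
    constructor covered
    field
      list   : List A
      size   : (D * length list) ^ 4 * 6 ^ j ≤ c ^ 4 * 6 ^ k
      covers : ∀ {F} → P F → F ∈ˡ list

  module _ {A : Set} where

    cover-none : ∀ {P : A → Set} {c j k} → (∀ {F} → ¬ P F) → Covered P c j k
    cover-none {c = c} {j} {k} np = covered [] (subst (λ z → z ^ 4 * 6 ^ j ≤ c ^ 4 * 6 ^ k) (≡-sym (*-zeroʳ D)) z≤n) (λ p → ⊥-elim (np p))

    cover-map : ∀ {P Q : A → Set} {c j k} (f : A → A) → Covered Q c j k →
      (∀ {F} → P F → ∃[ F′ ] Q F′ × F ≡ f F′) → Covered P c j k
    cover-map {P = P} {c = c} {j} {k} f (covered L s cov) h =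
      covered (map f L) (subst (λ l → (D * l) ^ 4 * 6 ^ j ≤ c ^ 4 * 6 ^ k) (≡-sym (length-map f L)) s) cov′
      where
      cov′ : ∀ {F} → P F → F ∈ˡ map f L
      cov′ p with h p
      ... | F′ , q , refl = ∈-map⁺ f (cov q)

    cover-mono : ∀ {P Q : A → Set} {c j k} → Covered Q c j k → (∀ {F} → P F → Q F) → Covered P c j k
    cover-mono (covered L s cov) h = covered L s (λ p → cov (h p))

    cover-∪ : ∀ {P Q : A → Set} {c e j k} → Covered P c j k → Covered Q e j k →
      Covered (λ F → P F ⊎ Q F) (c + e) j k
    cover-∪ {c = c} {e} {j} {k} (covered L s cov) (covered L′ s′ cov′) =
      covered (L ++ L′) size (λ { (inj₁ p) → ∈-++⁺ˡ (cov p) ; (inj₂ p) → ∈-++⁺ʳ L (cov′ p) })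
      where
      open ≤-Reasoning
      size : (D * length (L ++ L′)) ^ 4 * 6 ^ j ≤ (c + e) ^ 4 * 6 ^ k
      size = begin
        (D * length (L ++ L′)) ^ 4 * 6 ^ j
          ≡⟨ cong (λ l → l ^ 4 * 6 ^ j) (trans (cong (D *_) (length-++ L)) (*-distribˡ-+ D (length L) (length L′))) ⟩
        (D * length L + D * length L′) ^ 4 * 6 ^ j
          ≤⟨ scaled-+ (D * length L) (D * length L′) c e (6 ^ j) (6 ^ k) {{6^-nonZero {j}}} s s′ ⟩
        (c + e) ^ 4 * 6 ^ k ∎

    cover-Σ : ∀ {B : Set} {Q : B → A → Set} {w : B → ℕ} {j k} (xs : List B) →
      (∀ {x} → x ∈ˡ xs → Covered (Q x) (w x) j k) →
      Covered (λ F → ∃[ x ] x ∈ˡ xs × Q x F) (sum (map w xs)) j k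
    cover-Σ [] h = cover-none λ ()
    cover-Σ (x ∷ xs) h = cover-mono (cover-∪ (h (here refl)) (cover-Σ xs (λ i → h (there i))))
      λ { (_ , here refl , q) → inj₁ q ; (y , there i , q) → inj₂ (y , i , q) }

    cover-rescale : ∀ {P : A → Set} {c c′ j j′ k} → Covered P c j k → c ^ 4 * 6 ^ j′ ≤ c′ ^ 4 * 6 ^ j → Covered P c′ j′ k
    cover-rescale {c = c} {c′} {j} {j′} {k} (covered L s cov) h = covered L (*-cancelʳ-≤ _ _ (6 ^ j) {{6^-nonZero {j}}} (begin
      m * 6 ^ j′ * 6 ^ j         ≡⟨ swap-last m (6 ^ j′) (6 ^ j) ⟩
      m * 6 ^ j * 6 ^ j′         ≤⟨ *-monoˡ-≤ (6 ^ j′) s ⟩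
      c ^ 4 * 6 ^ k * 6 ^ j′     ≡⟨ swap-last (c ^ 4) (6 ^ k) (6 ^ j′) ⟩
      c ^ 4 * 6 ^ j′ * 6 ^ k     ≤⟨ *-monoˡ-≤ (6 ^ k) h ⟩
      c′ ^ 4 * 6 ^ j * 6 ^ k     ≡⟨ swap-last (c′ ^ 4) (6 ^ j) (6 ^ k) ⟩
      c′ ^ 4 * 6 ^ k * 6 ^ j     ∎)) cov
      where
      open ≤-Reasoning
      m = (D * length L) ^ 4

    cover-shift : ∀ {P : A → Set} {c k k′} j → Covered P c 0 k → k + j ≤ k′ → Covered P c j k′
    cover-shift {c = c} {k} {k′} j (covered L s cov) h = covered L (begin
      m * 6 ^ j               ≡⟨ cong (_* 6 ^ j) (*-identityʳ m) ⟨
      m * 1 * 6 ^ j           ≤⟨ *-monoˡ-≤ (6 ^ j) s ⟩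
      c ^ 4 * 6 ^ k * 6 ^ j   ≡⟨ *-assoc (c ^ 4) (6 ^ k) (6 ^ j) ⟩
      c ^ 4 * (6 ^ k * 6 ^ j) ≡⟨ cong (c ^ 4 *_) (^-distribˡ-+-* 6 k j) ⟨
      c ^ 4 * 6 ^ (k + j)     ≤⟨ *-monoʳ-≤ (c ^ 4) (^-monoʳ-≤ 6 h) ⟩
      c ^ 4 * 6 ^ k′          ∎) cov
      where
      open ≤-Reasoning
      m = (D * length L) ^ 4

  -- d · 6^(−d/4) is decreasing for d ≥ 2, because (3/2)^4 < 6.
  geometric-decay : ∀ {c e d₀ d} → 2 ≤ d₀ → d₀ ≤ d → (d₀ * D) ^ 4 * 1 ≤ c ^ 4 * 6 ^ (d₀ + e) →
    (d * D) ^ 4 * 1 ≤ c ^ 4 * 6 ^ (d + e)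
  geometric-decay {c} {e} {d₀} 2≤d₀ d₀≤d base with m≤n⇒∃[o]m+o≡n d₀≤d
  ... | o , refl = go o
    where
    open ≤-Reasoning
    -- From 2(d + 1) ≤ 3d, taking fourth powers and using 81 ≤ 16 · 6.
    step : ∀ d → 2 ≤ d → (suc d * D) ^ 4 ≤ 6 * (d * D) ^ 4
    step d 2≤d = *-cancelˡ-≤ 16 (begin
      16 * (suc d * D) ^ 4         ≡⟨ ^4-* 2 (suc d * D) ⟨
      (2 * (suc d * D)) ^ 4        ≤⟨ ^-monoˡ-≤ 4 (begin
          2 * (suc d * D)   ≡⟨ *-assoc 2 (suc d) D ⟨
          2 * suc d * D     ≤⟨ *-monoˡ-≤ D (begin
              2 * suc d     ≡⟨ *-suc 2 d ⟩
              2 + 2 * d     ≤⟨ +-monoˡ-≤ (2 * d) 2≤d ⟩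
              3 * d         ∎) ⟩
          3 * d * D         ≡⟨ *-assoc 3 d D ⟩
          3 * (d * D)       ∎) ⟩
      (3 * (d * D)) ^ 4            ≡⟨ ^4-* 3 (d * D) ⟩
      81 * (d * D) ^ 4             ≤⟨ *-monoˡ-≤ ((d * D) ^ 4) (evaluated {81} {96}) ⟩
      96 * (d * D) ^ 4             ≡⟨ *-assoc 16 6 ((d * D) ^ 4) ⟩
      16 * (6 * (d * D) ^ 4)       ∎)
    go : ∀ o → ((d₀ + o) * D) ^ 4 * 1 ≤ c ^ 4 * 6 ^ (d₀ + o + e)
    go zero rewrite +-identityʳ d₀ = base
    go (suc o) rewrite +-suc d₀ o = begin
      (suc (d₀ + o) * D) ^ 4 * 1        ≡⟨ *-identityʳ (((suc (d₀ + o)) * D) ^ 4) ⟩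
      (suc (d₀ + o) * D) ^ 4            ≤⟨ step (d₀ + o) (≤-trans 2≤d₀ (m≤m+n d₀ o)) ⟩
      6 * ((d₀ + o) * D) ^ 4            ≡⟨ cong (6 *_) (*-identityʳ (((d₀ + o) * D) ^ 4)) ⟨
      6 * (((d₀ + o) * D) ^ 4 * 1)      ≤⟨ *-monoʳ-≤ 6 (go o) ⟩
      6 * (c ^ 4 * 6 ^ (d₀ + o + e))    ≡⟨ *-assoc 6 (c ^ 4) _ ⟨
      6 * c ^ 4 * 6 ^ (d₀ + o + e)      ≡⟨ cong (_* 6 ^ (d₀ + o + e)) (*-comm 6 (c ^ 4)) ⟩
      c ^ 4 * 6 * 6 ^ (d₀ + o + e)      ≡⟨ *-assoc (c ^ 4) 6 _ ⟩
      c ^ 4 * 6 ^ suc (d₀ + o + e)      ∎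

-- The numerals in the bounds below are scaled by D and rounded up. For reference, 6^(−j/4) for j = 1, …, 7 is
-- 0.63894, 0.40825, 0.26085, 0.16667, 0.10649, 0.06804, 0.04347.
D : ℕ
D = 100000

open Bounds D public

-- Maximal dissociation sets of induced subgraphs

infixl 5 _∖_
_∖_ : ∀ {n} → Subset n → List (Fin n) → Subset n
U ∖ R = foldr (λ r W → W - r) U R

∈-∖⁺ : ∀ {n} {U : Subset n} R {v} → v ∈ U → v ∉ˡ R → v ∈ U ∖ R
∈-∖⁺ [] v∈U _ = v∈U
∈-∖⁺ (r ∷ R) v∈U v∉R = x∈p∧x≢y⇒x∈p-y (∈-∖⁺ R v∈U (v∉R ∘ there)) (v∉R ∘ here)

∉-minus : ∀ {n} (W : Subset n) r → r ∉ W - r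
∉-minus (inside ∷ W) zero ()
∉-minus (outside ∷ W) zero ()
∉-minus (b ∷ W) (suc r) (there p) = ∉-minus W r p

∈-∖⁻ : ∀ {n} {U : Subset n} R {v} → v ∈ U ∖ R → v ∈ U × v ∉ˡ R
∈-∖⁻ [] v∈ = v∈ , λ ()
∈-∖⁻ {U = U} (r ∷ R) v∈ with ∈-∖⁻ R (p─q⊆p (U ∖ R) ⁅ r ⁆ v∈)
... | v∈U , v∉R = v∈U , λ { (here refl) → ∉-minus (U ∖ R) r v∈ ; (there i) → v∉R i }

∣∖∣ : ∀ {n} {U : Subset n} {R} → Unique R → (∀ {r} → r ∈ˡ R → r ∈ U) → ∣ U ∖ R ∣ + length R ≤ ∣ U ∣
∣∖∣ {U = U} [] sub = ≤-reflexive (+-identityʳ ∣ U ∣)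
∣∖∣ {U = U} {r ∷ R} (r∉R ∷ u) sub = begin
  ∣ U ∖ (r ∷ R) ∣ + suc (length R)   ≡⟨ +-suc _ (length R) ⟩
  suc ∣ U ∖ (r ∷ R) ∣ + length R     ≤⟨ +-monoˡ-≤ (length R) (x∈p⇒∣p-x∣<∣p∣ (∈-∖⁺ R (sub (here refl)) λ i → All.lookup r∉R i refl)) ⟩
  ∣ U ∖ R ∣ + length R               ≤⟨ ∣∖∣ u (sub ∘ there) ⟩
  ∣ U ∣                              ∎
  where open ≤-Reasoning

adjoin : ∀ {n} → List (Fin n) → Subset n → Subset n
adjoin A F = foldr (λ a W → ⁅ a ⁆ ∪ W) F A

∈-adjoin⁻ : ∀ {n} {F : Subset n} A {v} → v ∈ adjoin A F → v ∈ˡ A ⊎ v ∈ F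
∈-adjoin⁻ [] v∈ = inj₂ v∈
∈-adjoin⁻ {F = F} (a ∷ A) v∈ with x∈p∪q⁻ ⁅ a ⁆ (adjoin A F) v∈
... | inj₁ p = inj₁ (here (x∈⁅y⁆⇒x≡y a p))
... | inj₂ p with ∈-adjoin⁻ A p
...   | inj₁ i = inj₁ (there i)
...   | inj₂ q = inj₂ q

∈-adjoin⁺ : ∀ {n} {F : Subset n} A {v} → v ∈ˡ A ⊎ v ∈ F → v ∈ adjoin A F
∈-adjoin⁺ [] (inj₂ p) = p
∈-adjoin⁺ (a ∷ A) (inj₁ (here refl)) = x∈p∪q⁺ (inj₁ (x∈⁅x⁆ a))
∈-adjoin⁺ (a ∷ A) (inj₁ (there i)) = x∈p∪q⁺ (inj₂ (∈-adjoin⁺ A (inj₁ i)))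
∈-adjoin⁺ (a ∷ A) (inj₂ p) = x∈p∪q⁺ (inj₂ (∈-adjoin⁺ A (inj₂ p)))

-- Maximum degree at most one, phrased as uniqueness of the neighbour inside `F`; this form needs no
-- counting.
Dissociated : ∀ {n} → Graph n → Subset n → Set
Dissociated G F = ∀ {v u w} → v ∈ F → u ∈ F → w ∈ F → Adj G v u → Adj G v w → u ≡ w

record MaxIn {n} (G : Graph n) (U F : Subset n) : Set where
  field
    sub : F ⊆ U
    diss : Dissociated G F
    maximal : ∀ {F′} → F′ ⊆ U → Dissociated G F′ → F ⊆ F′ → F′ ⊆ F
open MaxIn

module Neighbourhoods {n} (G : Graph n) where

  Adj-sym : ∀ {u v} → Adj G u v → Adj G v u
  Adj-sym {u} {v} = subst T (Graph.sym G u v)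

  Adj⇒≢ : ∀ {u v} → Adj G u v → u ≢ v
  Adj⇒≢ {u} a refl = subst T (Graph.irrefl G u) a

  nb : Subset n → Fin n → List (Fin n)
  nb U v = filter (λ u → u ∈? U ×-dec T? (E G v u)) (allFin n)

  deg : Subset n → Fin n → ℕ
  deg U v = length (nb U v)

  nb⁺ : ∀ {U v u} → u ∈ U → Adj G v u → u ∈ˡ nb U v
  nb⁺ {U} {v} {u} u∈U a = ∈-filter⁺ (λ u → u ∈? U ×-dec T? (E G v u)) (∈-allFin u) (u∈U , a)

  nb⁻ : ∀ {U v u} → u ∈ˡ nb U v → u ∈ U × Adj G v u
  nb⁻ {U} {v} i = proj₂ (∈-filter⁻ (λ u → u ∈? U ×-dec T? (E G v u)) {xs = allFin n} i)

  nb-unique : ∀ U v → Unique (nb U v)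
  nb-unique U v = Unique.filter⁺ (λ u → u ∈? U ×-dec T? (E G v u)) (Unique.allFin⁺ n)

  nb-sym : ∀ {U v u} → v ∈ U → u ∈ˡ nb U v → v ∈ˡ nb U u
  nb-sym v∈U i = nb⁺ v∈U (Adj-sym (proj₂ (nb⁻ i)))

  nb-∖⁻ : ∀ {U v u} R → u ∈ˡ nb (U ∖ R) v → u ∈ˡ nb U v × u ∉ˡ R
  nb-∖⁻ R i with nb⁻ i
  ... | u∈ , a with ∈-∖⁻ R u∈
  ... | u∈U , u∉R = nb⁺ u∈U a , u∉R

  nb-∖⁺ : ∀ {U v u} R → u ∈ˡ nb U v → u ∉ˡ R → u ∈ˡ nb (U ∖ R) v
  nb-∖⁺ R i u∉R with nb⁻ i
  ... | u∈ , a = nb⁺ (∈-∖⁺ R u∈ u∉R) a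

  deg-∖-≤ : ∀ {U v} R → deg (U ∖ R) v ≤ deg U v
  deg-∖-≤ {U} {v} R = length-mono-⊆ (nb-unique (U ∖ R) v) λ i → proj₁ (nb-∖⁻ R i)

  deg-∖-< : ∀ {U v x} R → x ∈ˡ nb U v → x ∈ˡ R → deg (U ∖ R) v < deg U v
  deg-∖-< {U} {v} {x} R x∈ x∈R = length-mono-⊆ (All.tabulate (λ { i refl → proj₂ (nb-∖⁻ R i) x∈R }) ∷ nb-unique (U ∖ R) v)
    λ { (here refl) → x∈ ; (there i) → proj₁ (nb-∖⁻ R i) }

  deg-minus : ∀ {U v} x → deg U v ≤ suc (deg (U ∖ (x ∷ [])) v)
  deg-minus {U} {v} x = length-mono-⊆ {ys = x ∷ nb (U ∖ (x ∷ [])) v} (nb-unique U v) sub′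
    where
    sub′ : ∀ {u} → u ∈ˡ nb U v → u ∈ˡ x ∷ nb (U ∖ (x ∷ [])) v
    sub′ {u} i with u ≟ᶠ x
    ... | yes refl = here refl
    ... | no u≢x = there (nb-∖⁺ (x ∷ []) i λ { (here p) → u≢x p })

  deg-minus-nonadj : ∀ {U v} x → x ∉ˡ nb U v → deg U v ≤ deg (U ∖ (x ∷ [])) v
  deg-minus-nonadj {U} {v} x x∉ = length-mono-⊆ (nb-unique U v)
    λ i → nb-∖⁺ (x ∷ []) i λ { (here refl) → x∉ i }

  -- When `A` lies in `R`, the last two fields say that `F` meets `R` exactly in `A`. Such an `F` is
  -- determined by its part outside `R`, which is why `restrict` can pass to the smaller vertex set.
  record Split (U : Subset n) (A R : List (Fin n)) (F : Subset n) : Set where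
    field
      max : MaxIn G U F
      chosen : ∀ {a} → a ∈ˡ A → a ∈ F
      decided : ∀ {r} → r ∈ˡ R → r ∈ F → r ∈ˡ A

  -- A has no neighbours in U outside R, so a dissociation set of U ∖ R remains one after A is added.
  restrict : ∀ {U A R} → (∀ {a} → a ∈ˡ A → a ∈ˡ R) → (∀ {a u} → a ∈ˡ A → u ∈ˡ nb U a → u ∈ˡ R) →
    ∀ {F} → Split U A R F → ∃[ F′ ] MaxIn G (U ∖ R) F′ × F ≡ adjoin A F′
  restrict {U} {A} {R} A⊆R closed {F} s = F₀ , record
      { sub = λ p → proj₂ (x∈p∩q⁻ F (U ∖ R) p)
      ; diss = λ v∈ u∈ w∈ → diss max (F₀⊆F v∈) (F₀⊆F u∈) (F₀⊆F w∈)
      ; maximal = λ sub′ d′ F₀⊆F′ {v} v∈ → x∈p∩q⁺ (maximal max (adjoin⊆U sub′) (adjoin-diss sub′ d′) (F⊆adjoin F₀⊆F′) (∈-adjoin⁺ A (inj₂ v∈)) , sub′ v∈)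
      } , ⊆-antisym (F⊆adjoin (λ z → z)) (λ p → [ chosen , F₀⊆F ]′ (∈-adjoin⁻ A p))
    where
    open Split s
    F₀ = F ∩ (U ∖ R)
    F₀⊆F : F₀ ⊆ F
    F₀⊆F p = proj₁ (x∈p∩q⁻ F (U ∖ R) p)
    _∈ˡ?_ : ∀ v (xs : List (Fin n)) → Dec (v ∈ˡ xs)
    v ∈ˡ? xs = Any.any? (v ≟ᶠ_) xs
    F⊆adjoin : ∀ {F′} → F₀ ⊆ F′ → F ⊆ adjoin A F′
    F⊆adjoin F₀⊆F′ {v} v∈F with v ∈ˡ? R
    ... | yes v∈R = ∈-adjoin⁺ A (inj₁ (decided v∈R v∈F))
    ... | no v∉R = ∈-adjoin⁺ A (inj₂ (F₀⊆F′ (x∈p∩q⁺ (v∈F , ∈-∖⁺ R (sub max v∈F) v∉R))))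
    adjoin⊆U : ∀ {F′} → F′ ⊆ U ∖ R → adjoin A F′ ⊆ U
    adjoin⊆U sub′ p with ∈-adjoin⁻ A p
    ... | inj₁ i = sub max (chosen i)
    ... | inj₂ q = proj₁ (∈-∖⁻ R (sub′ q))
    adjoin-diss : ∀ {F′} → F′ ⊆ U ∖ R → Dissociated G F′ → Dissociated G (adjoin A F′)
    adjoin-diss {F′} sub′ d′ {v} {u} {w} v∈ u∈ w∈ vu vw with ∈-adjoin⁻ A v∈
    ... | inj₁ v∈A = diss max (chosen v∈A) (chosen (inA u∈ vu)) (chosen (inA w∈ vw)) vu vw
      where
      inA : ∀ {x} → x ∈ adjoin A F′ → Adj G v x → x ∈ˡ A
      inA x∈ vx with ∈-adjoin⁻ A x∈
      ... | inj₁ i = i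
      ... | inj₂ x∈F′ = ⊥-elim (proj₂ (∈-∖⁻ R (sub′ x∈F′)) (closed v∈A (nb⁺ (proj₁ (∈-∖⁻ R (sub′ x∈F′))) vx)))
    ... | inj₂ v∈F′ = d′ v∈F′ (inF′ u∈ vu) (inF′ w∈ vw) vu vw
      where
      inF′ : ∀ {x} → x ∈ adjoin A F′ → Adj G v x → x ∈ F′
      inF′ x∈ vx with ∈-adjoin⁻ A x∈
      ... | inj₂ q = q
      ... | inj₁ x∈A = ⊥-elim (proj₂ (∈-∖⁻ R (sub′ v∈F′)) (closed x∈A (nb⁺ (proj₁ (∈-∖⁻ R (sub′ v∈F′))) (Adj-sym vx))))

  addable : ∀ {U F y} → MaxIn G U F → y ∈ U → Dissociated G (⁅ y ⁆ ∪ F) → y ∈ F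
  addable {U} {F} {y} m y∈U d = maximal m sub′ d (q⊆p∪q ⁅ y ⁆ F) (x∈p∪q⁺ (inj₁ (x∈⁅x⁆ y)))
    where
    sub′ : ⁅ y ⁆ ∪ F ⊆ U
    sub′ p with x∈p∪q⁻ ⁅ y ⁆ F p
    ... | inj₁ q = subst (_∈ U) (≡-sym (x∈⁅y⁆⇒x≡y y q)) y∈U
    ... | inj₂ q = sub m q

  -- Adding `y` can create only the edge yz, and `z` has no neighbour in `F`; the enlarged set is
  -- still a dissociation set, so maximality puts `y` into `F`.
  addable-pendant : ∀ {U F y z} → MaxIn G U F → y ∈ U → (∀ {u} → u ∈ F → Adj G y u → u ≡ z) →
    (∀ {w} → z ∈ F → w ∈ F → Adj G z w → ⊥) → y ∈ F
  addable-pendant {U} {F} {y} {z} m y∈U only free = addable m y∈U d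
    where
    mem : ∀ {v} → v ∈ ⁅ y ⁆ ∪ F → v ≡ y ⊎ v ∈ F
    mem p with x∈p∪q⁻ ⁅ y ⁆ F p
    ... | inj₁ q = inj₁ (x∈⁅y⁆⇒x≡y y q)
    ... | inj₂ q = inj₂ q
    clash : ∀ {v w} → v ∈ F → w ∈ F → Adj G v y → Adj G v w → ⊥
    clash v∈F w∈F vy vw with only v∈F (Adj-sym vy)
    ... | refl = free v∈F w∈F vw
    d : Dissociated G (⁅ y ⁆ ∪ F)
    d {v} {u} {w} v∈ u∈ w∈ vu vw with mem v∈ | mem u∈ | mem w∈
    ... | inj₁ refl | inj₁ refl | _ = ⊥-elim (Adj⇒≢ vu refl)
    ... | inj₁ refl | _ | inj₁ refl = ⊥-elim (Adj⇒≢ vw refl)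
    ... | inj₁ refl | inj₂ u∈F | inj₂ w∈F = trans (only u∈F vu) (≡-sym (only w∈F vw))
    ... | inj₂ v∈F | inj₁ refl | inj₁ refl = refl
    ... | inj₂ v∈F | inj₁ refl | inj₂ w∈F = ⊥-elim (clash v∈F w∈F vu vw)
    ... | inj₂ v∈F | inj₂ u∈F | inj₁ refl = ⊥-elim (clash v∈F u∈F vw vu)
    ... | inj₂ v∈F | inj₂ u∈F | inj₂ w∈F = diss m v∈F u∈F w∈F vu vw

  addable-isolated : ∀ {U F y} → MaxIn G U F → y ∈ U → (∀ {u} → u ∈ F → Adj G y u → ⊥) → y ∈ F
  addable-isolated {y = y} m y∈U none = addable-pendant {z = y} m y∈U (λ u∈F a → ⊥-elim (none u∈F a)) (λ _ w∈F a → none w∈F a)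

  Matched : Subset n → Fin n → Fin n → Subset n → Set
  Matched U x y = Split U (x ∷ y ∷ []) (nb U x ++ nb U y)

  SomeMatch : Subset n → Fin n → Subset n → Set
  SomeMatch U x F = ∃[ y ] y ∈ˡ nb U x × Matched U x y F

  -- An edge inside a dissociation set is a whole component of it, so all other neighbours of its
  -- ends are absent. The list of deleted vertices contains `x` and `y` themselves, each being a
  -- neighbour of the other.
  matched : ∀ {U F x y} → MaxIn G U F → x ∈ F → y ∈ F → Adj G x y → Matched U x y F
  matched {U} {F} {x} {y} m x∈F y∈F xy = record
    { max = m
    ; chosen = λ { (here refl) → x∈F ; (there (here refl)) → y∈F }
    ; decided = λ {r} i r∈F → case i r∈F }
    where
    case : ∀ {r} → r ∈ˡ nb U x ++ nb U y → r ∈ F → r ∈ˡ x ∷ y ∷ []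
    case i r∈F with ∈-++⁻ (nb U x) i
    ... | inj₁ j = there (here (diss m x∈F r∈F y∈F (proj₂ (nb⁻ j)) xy))
    ... | inj₂ j = here (diss m y∈F r∈F x∈F (proj₂ (nb⁻ j)) (Adj-sym xy))

  cover-split : ∀ {U A R c j k} → (∀ {a} → a ∈ˡ A → a ∈ˡ R) → (∀ {a u} → a ∈ˡ A → u ∈ˡ nb U a → u ∈ˡ R) →
    Covered (MaxIn G (U ∖ R)) c j k → Covered (Split U A R) c j k
  cover-split {A = A} A⊆R closed cov = cover-map (adjoin A) cov (restrict A⊆R closed)

  cover-matched : ∀ {U x y c j k} → x ∈ U → y ∈ˡ nb U x →
    Covered (MaxIn G (U ∖ (nb U x ++ nb U y))) c j k → Covered (Matched U x y) c j k
  cover-matched {U} {x} {y} x∈U y∈ = cover-split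
    (λ { (here refl) → ∈-++⁺ʳ (nb U x) (nb-sym x∈U y∈) ; (there (here refl)) → ∈-++⁺ˡ y∈ })
    (λ { (here refl) i → ∈-++⁺ˡ i ; (there (here refl)) i → ∈-++⁺ʳ (nb U x) i })

  cover-alone : ∀ {U x c j k} → Covered (MaxIn G (U ∖ (x ∷ nb U x))) c j k → Covered (Split U (x ∷ []) (x ∷ nb U x)) c j k
  cover-alone = cover-split (λ { (here refl) → here refl }) (λ { (here refl) i → there i })

  cover-absent : ∀ {U x c j k} → Covered (MaxIn G (U ∖ (x ∷ []))) c j k → Covered (Split U [] (x ∷ [])) c j k
  cover-absent = cover-split (λ ()) (λ ())

  alone-or-matched : ∀ {U F x} → MaxIn G U F → x ∈ F → Split U (x ∷ []) (x ∷ nb U x) F ⊎ SomeMatch U x F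
  alone-or-matched {U} {F} {x} m x∈F with Any.any? (_∈? F) (nb U x)
  ... | yes p with find p
  ...   | y , y∈ , y∈F = inj₂ (y , y∈ , matched m x∈F y∈F (proj₂ (nb⁻ y∈)))
  alone-or-matched {U} {F} {x} m x∈F | no ¬p = inj₁ (record
    { max = m
    ; chosen = λ { (here refl) → x∈F }
    ; decided = λ { (here refl) _ → here refl ; (there i) r∈F → ⊥-elim (¬p (Any.map (λ { refl → r∈F }) i)) } })

  branch : ∀ {U x c₁ c₂ c₃ j k} →
    Covered (MaxIn G (U ∖ (x ∷ []))) c₁ j k → Covered (MaxIn G (U ∖ (x ∷ nb U x))) c₂ j k →
    Covered (SomeMatch U x) c₃ j k → Covered (MaxIn G U) (c₁ + (c₂ + c₃)) j k
  branch {U} {x} out alone some = cover-mono (cover-∪ (cover-absent out) (cover-∪ (cover-alone alone) some)) cases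
    where
    cases : ∀ {F} → MaxIn G U F → _
    cases {F} m with x ∈? F
    ... | yes x∈F = inj₂ (alone-or-matched m x∈F)
    ... | no x∉F = inj₁ (record { max = m ; chosen = λ () ; decided = λ { (here refl) p → ⊥-elim (x∉F p) } })

  branch-isolated : ∀ {U y c j k} → y ∈ U → nb U y ≡ [] → Covered (MaxIn G (U ∖ (y ∷ []))) c j k → Covered (MaxIn G U) c j k
  branch-isolated {U} {y} {c} {j} {k} y∈U eq cov = cover-mono (cover-alone (subst (λ l → Covered (MaxIn G (U ∖ (y ∷ l))) c j k) (≡-sym eq) cov)) cases
    where
    none : ∀ {u} → u ∈ U → Adj G y u → ⊥
    none u∈U a with subst (_ ∈ˡ_) eq (nb⁺ u∈U a)
    ... | ()
    cases : ∀ {F} → MaxIn G U F → Split U (y ∷ []) (y ∷ nb U y) F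
    cases m with alone-or-matched m (addable-isolated m y∈U λ u∈F → none (sub m u∈F))
    ... | inj₁ s = s
    ... | inj₂ (_ , i , _) = ⊥-elim (none (proj₁ (nb⁻ i)) (proj₂ (nb⁻ i)))

  -- A maximal set avoiding the leaf `y` must contain `z` and some neighbour of `z`, since otherwise
  -- `y` could be added. So there is no separate branch for the absence of `y`; sets containing both
  -- `y` and `z` are counted among the matchings of `z`.
  branch-leaf : ∀ {U y z c₁ c₂ j k} → y ∈ U → nb U y ≡ z ∷ [] →
    Covered (MaxIn G (U ∖ (y ∷ z ∷ []))) c₁ j k → Covered (SomeMatch U z) c₂ j k → Covered (MaxIn G U) (c₁ + c₂) j k
  branch-leaf {U} {y} {z} {c₁} {c₂} {j} {k} y∈U eq alone some =
    cover-mono (cover-∪ (cover-alone (subst (λ l → Covered (MaxIn G (U ∖ (y ∷ l))) c₁ j k) (≡-sym eq) alone)) some) cases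
    where
    z∈ : z ∈ˡ nb U y
    z∈ = subst (z ∈ˡ_) (≡-sym eq) (here refl)
    only : ∀ {u} → u ∈ U → Adj G y u → u ≡ z
    only u∈U a with subst (_ ∈ˡ_) eq (nb⁺ u∈U a)
    ... | here p = p
    cases : ∀ {F} → MaxIn G U F → Split U (y ∷ []) (y ∷ nb U y) F ⊎ SomeMatch U z F
    cases {F} m with y ∈? F
    ... | yes y∈F with alone-or-matched m y∈F
    ...   | inj₁ s = inj₁ s
    ...   | inj₂ (w , w∈ , s) with only (proj₁ (nb⁻ w∈)) (proj₂ (nb⁻ w∈))
    ...     | refl = inj₂ (y , nb-sym y∈U w∈ , matched m (Split.chosen s (there (here refl))) y∈F (Adj-sym (proj₂ (nb⁻ w∈))))
    cases {F} m | no y∉F with z ∈? F | Any.any? (_∈? F) (nb U z)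
    ... | yes z∈F | yes p with find p
    ...   | w , w∈ , w∈F = inj₂ (w , w∈ , matched m z∈F w∈F (proj₂ (nb⁻ w∈)))
    cases {F} m | no y∉F | no z∉F | _ = ⊥-elim (y∉F (addable-pendant {z = z} m y∈U (λ u∈F → only (sub m u∈F)) (λ z∈F → ⊥-elim (z∉F z∈F))))
    cases {F} m | no y∉F | yes _ | no ¬p = ⊥-elim (y∉F (addable-pendant {z = z} m y∈U (λ u∈F → only (sub m u∈F))
      (λ _ w∈F a → ¬p (Any.map (λ { refl → w∈F }) (nb⁺ (sub m w∈F) a)))))

-- Estimates relative to 6^(|U|/4)

sum-const : ∀ {A : Set} c (xs : List A) → sum (map (λ _ → c) xs) ≡ length xs * c
sum-const c [] = refl
sum-const c (_ ∷ xs) = cong (c +_) (sum-const c xs)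

slower : ∀ {a} c {j j′} → j ≤ j′ → a ≤ c ^ 4 * 6 ^ j → a ≤ c ^ 4 * 6 ^ j′
slower c j≤j′ h = ≤-trans h (*-monoʳ-≤ (c ^ 4) (^-monoʳ-≤ 6 j≤j′))

module _ {A : Set} {P : A → Set} where

  cover-weaken : ∀ {c c′ k} → c ≤ c′ → Covered P c 0 k → Covered P c′ 0 k
  cover-weaken le cov = cover-rescale cov (*-monoˡ-≤ 1 (^-monoˡ-≤ 4 le))

  cover-weaken! : ∀ {c k} c′ {_ : True (c ≤? c′)} → Covered P c 0 k → Covered P c′ 0 k
  cover-weaken! c′ {w} = cover-weaken (toWitness w)

  cover-rescale! : ∀ {c j k} c′ {_ : True (c ^ 4 * 1 ≤? c′ ^ 4 * 6 ^ j)} → Covered P c j k → Covered P c′ 0 k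
  cover-rescale! c′ {w} cov = cover-rescale cov (toWitness w)

module Estimates {n} (G : Graph n) (triangle-free : TriangleFree G) where

  open Neighbourhoods G

  nb-∌ : ∀ {U x} → x ∉ˡ nb U x
  nb-∌ i = Adj⇒≢ (proj₂ (nb⁻ i)) refl

  nb-unique⁺ : ∀ U x → Unique (x ∷ nb U x)
  nb-unique⁺ U x = All.tabulate (λ { i refl → nb-∌ {U} i }) ∷ nb-unique U x

  nb-sub⁺ : ∀ {U x} → x ∈ U → ∀ {r} → r ∈ˡ x ∷ nb U x → r ∈ U
  nb-sub⁺ x∈U (here refl) = x∈U
  nb-sub⁺ x∈U (there i) = proj₁ (nb⁻ i)

  -- Every appeal to triangle-freeness passes through here. The three neighbourhoods may be taken in
  -- different induced subgraphs.
  nb-disjoint : ∀ {U V W x y z} → y ∈ˡ nb U x → z ∈ˡ nb V x → z ∈ˡ nb W y → ⊥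
  nb-disjoint i j l = triangle-free _ _ _ (proj₂ (nb⁻ i) , proj₂ (nb⁻ l) , proj₂ (nb⁻ j))

  nb-++-unique : ∀ {U x y} → y ∈ˡ nb U x → Unique (nb U x ++ nb U y)
  nb-++-unique {U} {x} {y} y∈ = Unique.++⁺ (nb-unique U x) (nb-unique U y) λ { (i , j) → nb-disjoint y∈ i j }

  nb-++-sub : ∀ {U x y r} → r ∈ˡ nb U x ++ nb U y → r ∈ U
  nb-++-sub {U} {x} i = [ (λ j → proj₁ (nb⁻ j)) , (λ j → proj₁ (nb⁻ j)) ]′ (∈-++⁻ (nb U x) i)

  -- Deleting at least `j` vertices turns a bound relative to the smaller set into one relative to
  -- `U`, with the gain α^(-j).
  lift : ∀ {U R c} j → Covered (MaxIn G (U ∖ R)) c 0 ∣ U ∖ R ∣ → Unique R → (∀ {r} → r ∈ˡ R → r ∈ U) →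
    j ≤ length R → Covered (MaxIn G (U ∖ R)) c j ∣ U ∣
  lift {U} {R} j cov u sub le = cover-shift j cov (≤-trans (+-monoʳ-≤ ∣ U ∖ R ∣ le) (∣∖∣ u sub))

  -- The sets considered satisfy `∣ U ∣ ≤ m`, while `hyp` needs strictly fewer vertices; `shrink`
  -- bridges this by deleting at least one. The weak inequality passes to subsets, so these lemmas
  -- can also be applied to one another after deletions.
  module Induction (m : ℕ) (hyp : ∀ W → ∣ W ∣ < m → Covered (MaxIn G W) D 0 ∣ W ∣) where

    shrink : ∀ {U R} j → ∣ U ∣ ≤ m → Unique R → (∀ {r} → r ∈ˡ R → r ∈ U) → suc j ≤ length R →
      Covered (MaxIn G (U ∖ R)) D (suc j) ∣ U ∣
    shrink {U} {R} j U≤m u sub le = lift (suc j) (hyp (U ∖ R) (begin-strict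
      ∣ U ∖ R ∣              <⟨ m<m+n ∣ U ∖ R ∣ (≤-trans (s≤s z≤n) le) ⟩
      ∣ U ∖ R ∣ + length R   ≤⟨ ∣∖∣ u sub ⟩
      ∣ U ∣                  ≤⟨ U≤m ⟩
      m                      ∎)) u sub le
      where open ≤-Reasoning

    match-cover : ∀ {U x y} j → ∣ U ∣ ≤ m → x ∈ U → y ∈ˡ nb U x → suc j ≤ deg U x + deg U y →
      Covered (Matched U x y) D (suc j) ∣ U ∣
    match-cover {U} {x} {y} j U≤m x∈U y∈ le = cover-matched x∈U y∈
      (shrink j U≤m (nb-++-unique y∈) (nb-++-sub {U} {x} {y}) (subst (suc j ≤_) (≡-sym (length-++ (nb U x))) le))

    alone-cover : ∀ {U x} j → ∣ U ∣ ≤ m → x ∈ U → j ≤ deg U x → Covered (MaxIn G (U ∖ (x ∷ nb U x))) D (suc j) ∣ U ∣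
    alone-cover {U} {x} j U≤m x∈U le = shrink j U≤m (nb-unique⁺ U x) (nb-sub⁺ x∈U) (s≤s le)

    -- With d = `deg U x`, the matchings of `x` contribute at most d · α^(-(d + e)). This does not
    -- increase for d ≥ 2, so one numerical check at `d₀` covers all larger degrees.
    some-match-cover : ∀ {U x} e d₀ c → ∣ U ∣ ≤ m → x ∈ U → (∀ {y} → y ∈ˡ nb U x → e ≤ deg U y) →
      2 ≤ d₀ → d₀ ≤ deg U x → {_ : True ((d₀ * D) ^ 4 * 1 ≤? c ^ 4 * 6 ^ (d₀ + e))} →
      Covered (SomeMatch U x) c 0 ∣ U ∣
    some-match-cover {U} {x} e d₀ c U≤m x∈U low 2≤d₀ d₀≤ {base} = cover-rescale
      (subst (λ w → Covered (SomeMatch U x) w (deg U x + e) ∣ U ∣) (sum-const D (nb U x)) (cover-Σ (nb U x) each))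
      (geometric-decay {c} {e} 2≤d₀ d₀≤ (toWitness base))
      where
      -- `match-cover` asks for a positive exponent, in the form of a successor.
      suc-pred-deg : ∃[ d ] deg U x + e ≡ suc d
      suc-pred-deg with deg U x | ≤-trans 2≤d₀ d₀≤
      ... | suc d | _ = d + e , refl
      each : ∀ {y} → y ∈ˡ nb U x → Covered (Matched U x y) D (deg U x + e) ∣ U ∣
      each {y} y∈ with suc-pred-deg
      ... | d , eq = subst (λ j → Covered (Matched U x y) D j ∣ U ∣) (≡-sym eq)
        (match-cover d U≤m x∈U y∈ (≤-trans (≤-reflexive (≡-sym eq)) (+-monoʳ-≤ (deg U x) (low y∈))))

    data Size : ℕ → Set where
      none : Size 0
      one  : Size 1
      more : ∀ {e} → 2 ≤ e → Size e

    size? : ∀ e → Size e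
    size? zero = none
    size? (suc zero) = one
    size? (suc (suc e)) = more (s≤s (s≤s z≤n))

    low-neighbours : ∀ {U y} → deg U y ≤ 1 → nb U y ≡ [] ⊎ ∃[ z ] nb U y ≡ z ∷ []
    low-neighbours {U} {y} le with nb U y | le
    ... | [] | _ = inj₁ refl
    ... | z ∷ [] | _ = inj₂ (z , refl)
    ... | _ ∷ _ ∷ _ | s≤s ()

    -- If `z` has e neighbours besides `y`, matching it with `y` deletes at least e + 2 vertices and
    -- matching it with another one at least e + 3. The sum α^(-e-2) + e · α^(-e-3) is largest at e
    -- = 1, where it is 0.26085 + 0.16667.
    leaf-no-cherry : ∀ {U y z c} → ∣ U ∣ ≤ m → y ∈ U → nb U y ≡ z ∷ [] →
      (∀ {w} → w ∈ˡ nb U z → w ≢ y → 2 ≤ deg U w) →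
      Covered (MaxIn G (U ∖ (y ∷ z ∷ []))) c 0 ∣ U ∣ → Covered (MaxIn G U) (c + 42755) 0 ∣ U ∣
    leaf-no-cherry {U} {y} {z} {c} U≤m y∈U eq high cov =
      branch-leaf y∈U eq cov (cover-mono (combine (size? e) leaf others) cases)
      where
      e = deg (U ∖ (y ∷ [])) z
      z∈ : z ∈ˡ nb U y
      z∈ = subst (z ∈ˡ_) (≡-sym eq) (here refl)
      z∈U : z ∈ U
      z∈U = proj₁ (nb⁻ z∈)
      y∈ : y ∈ˡ nb U z
      y∈ = nb-sym y∈U z∈
      e<deg : suc e ≤ deg U z
      e<deg = deg-∖-< (y ∷ []) y∈ (here refl)
      Others : Subset n → Set
      Others F = ∃[ w ] w ∈ˡ nb (U ∖ (y ∷ [])) z × Matched U z w F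
      leaf : Covered (Matched U z y) D (suc (e + 1)) ∣ U ∣
      leaf = match-cover (e + 1) U≤m z∈U y∈ (+-mono-≤ e<deg (≤-reflexive (cong length (≡-sym eq))))
      others : Covered Others (e * D) (suc (e + 2)) ∣ U ∣
      others = subst (λ w → Covered Others w (suc (e + 2)) ∣ U ∣) (sum-const D (nb (U ∖ (y ∷ [])) z))
        (cover-Σ (nb (U ∖ (y ∷ [])) z) λ i → let w∈ , w∉ = nb-∖⁻ (y ∷ []) i in
          match-cover (e + 2) U≤m z∈U w∈ (+-mono-≤ e<deg (high w∈ (w∉ ∘ here))))
      combine : ∀ {e P Q} → Size e → Covered P D (suc (e + 1)) ∣ U ∣ → Covered Q (e * D) (suc (e + 2)) ∣ U ∣ →
        Covered (λ F → P F ⊎ Q F) 42755 0 ∣ U ∣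
      combine none p q = cover-weaken! 42755 (cover-∪ (cover-rescale! 40830 p) (cover-rescale! 0 q))
      combine one p q = cover-weaken! 42755 (cover-∪ (cover-rescale! 26085 p) (cover-rescale! 16670 q))
      combine {e} (more 2≤e) p q = cover-weaken! 42755 (cover-∪
        (cover-rescale {c′ = 16670} {j′ = 0} p (slower {D ^ 4 * 1} 16670 {4} (s≤s (+-monoˡ-≤ 1 2≤e)) (evaluated {D ^ 4 * 1} {16670 ^ 4 * 6 ^ 4})))
        (cover-rescale {c′ = 21310} {j′ = 0} q (slower {(e * D) ^ 4 * 1} 21310 {e + 3} (≤-reflexive (+-suc e 2))
          (geometric-decay {21310} {3} {2} {e} ≤-refl 2≤e (evaluated {(2 * D) ^ 4 * 1} {21310 ^ 4 * 6 ^ 5})))))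
      cases : ∀ {F} → SomeMatch U z F → Matched U z y F ⊎ Others F
      cases (w , w∈ , s) with w ≟ᶠ y
      ... | yes refl = inj₁ s
      ... | no w≢y = inj₂ (w , nb-∖⁺ (y ∷ []) w∈ (λ { (here p) → w≢y p }) , s)

    -- Once `y` and `z` are gone, `w` is isolated and belongs to every maximal set, so it can be
    -- deleted too. The constant 0.52175 bounds 2α^(-3), for the matchings of `z`, which has at
    -- least the two neighbours `y` and `w`.
    leaf-cherry : ∀ {U y z w c} → ∣ U ∣ ≤ m → y ∈ U → nb U y ≡ z ∷ [] → w ∈ˡ nb U z → w ≢ y → deg U w ≤ 1 →
      Covered (MaxIn G (U ∖ (w ∷ y ∷ z ∷ []))) c 0 ∣ U ∣ → Covered (MaxIn G U) (c + 52175) 0 ∣ U ∣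
    leaf-cherry {U} {y} {z} {w} {c} U≤m y∈U eq w∈ w≢y low cov =
      branch-leaf y∈U eq
        (branch-isolated w∈W isolated cov)
        (some-match-cover 1 2 52175 U≤m z∈U (λ i → 1≤deg (nb-sym z∈U i)) (≤-refl) two)
      where
      z∈ : z ∈ˡ nb U y
      z∈ = subst (z ∈ˡ_) (≡-sym eq) (here refl)
      z∈U : z ∈ U
      z∈U = proj₁ (nb⁻ z∈)
      1≤deg : ∀ {v u} → u ∈ˡ nb U v → 1 ≤ deg U v
      1≤deg {v} i with nb U v
      ... | _ ∷ _ = s≤s z≤n
      two : 2 ≤ deg U z
      two = length-mono-⊆ {xs = w ∷ y ∷ []} ((w≢y ∷ []) ∷ [] ∷ []) λ { (here refl) → w∈ ; (there (here refl)) → nb-sym y∈U z∈ }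
      w∈W : w ∈ U ∖ (y ∷ z ∷ [])
      w∈W = ∈-∖⁺ (y ∷ z ∷ []) (proj₁ (nb⁻ w∈)) λ { (here p) → w≢y p ; (there (here refl)) → nb-∌ w∈ }
      isolated : nb (U ∖ (y ∷ z ∷ [])) w ≡ []
      isolated with nb (U ∖ (y ∷ z ∷ [])) w | ≤-trans (deg-∖-< (y ∷ z ∷ []) (nb-sym z∈U w∈) (there (here refl))) low
      ... | [] | _ = refl
      ... | _ ∷ _ | s≤s ()

    -- A cherry is a pair of leaves `y` and `w` with the common neighbour `z`.
    cherry? : ∀ U y z → (∃[ w ] w ∈ˡ nb U z × w ≢ y × deg U w ≤ 1) ⊎ (∀ {w} → w ∈ˡ nb U z → w ≢ y → 2 ≤ deg U w)
    cherry? U y z with Any.any? (λ w → ¬? (w ≟ᶠ y) ×-dec (deg U w ≤? 1)) (nb U z)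
    ... | yes p = inj₁ (find p)
    ... | no ¬p = inj₂ λ i w≢y → ≰⇒> λ le → ¬p (Any.map (λ { refl → w≢y , le }) i)

    unique₂ : ∀ {y z : Fin n} → y ≢ z → Unique (y ∷ z ∷ [])
    unique₂ y≢z = (y≢z ∷ []) ∷ [] ∷ []

    unique₃ : ∀ {y z w : Fin n} → w ≢ y → w ≢ z → y ≢ z → Unique (w ∷ y ∷ z ∷ [])
    unique₃ w≢y w≢z y≢z = (w≢y ∷ w≢z ∷ []) ∷ unique₂ y≢z

    record Low (U : Subset n) (y : Fin n) : Set where
      constructor low
      field
        member : y ∈ U
        deg≤1 : deg U y ≤ 1

    low-∖ : ∀ {U y} R → Low U y → y ∉ˡ R → Low (U ∖ R) y
    low-∖ {U} {y} R (low y∈U d) y∉ = low (∈-∖⁺ R y∈U y∉) (≤-trans (deg-∖-≤ R) d)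

    ∖-≤ : ∀ {U : Subset n} R → ∣ U ∣ ≤ m → ∣ U ∖ R ∣ ≤ m
    ∖-≤ R U≤m = ≤-trans (p⊆q⇒∣p∣≤∣q∣ λ p → proj₁ (∈-∖⁻ R p)) U≤m

    module Leaf {U y} (U≤m : ∣ U ∣ ≤ m) (y∈U : y ∈ U) {z} (eq : nb U y ≡ z ∷ []) where
      z∈ : z ∈ˡ nb U y
      z∈ = subst (z ∈ˡ_) (≡-sym eq) (here refl)
      y≢z : y ≢ z
      y≢z = Adj⇒≢ (proj₂ (nb⁻ z∈))
      sub₂ : ∀ {r} → r ∈ˡ y ∷ z ∷ [] → r ∈ U
      sub₂ (here refl) = y∈U
      sub₂ (there (here refl)) = proj₁ (nb⁻ z∈)
      module _ {w} (w∈ : w ∈ˡ nb U z) where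
        w≢z : w ≢ z
        w≢z refl = nb-∌ w∈
        sub₃ : ∀ {r} → r ∈ˡ w ∷ y ∷ z ∷ [] → r ∈ U
        sub₃ (here refl) = proj₁ (nb⁻ w∈)
        sub₃ (there i) = sub₂ i

    isolated-cover : ∀ {U y} → ∣ U ∣ ≤ m → y ∈ U → nb U y ≡ [] → Covered (MaxIn G U) 63895 0 ∣ U ∣
    isolated-cover {U} {y} U≤m y∈U eq = branch-isolated y∈U eq
      (cover-rescale! 63895 (shrink 0 U≤m ([] ∷ []) (λ { (here refl) → y∈U }) ≤-refl))

    -- The case without a cherry is the worst: 0.40825 + 0.42755. A cherry gives 0.26085 + 0.52175,
    -- an isolated vertex 0.63895.
    low-cover : ∀ {U y} → ∣ U ∣ ≤ m → Low U y → Covered (MaxIn G U) 83580 0 ∣ U ∣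
    low-cover {U} {y} U≤m (low y∈U d) with low-neighbours {U} d
    ... | inj₁ eq = cover-weaken! 83580 (isolated-cover U≤m y∈U eq)
    ... | inj₂ (z , eq) with cherry? U y z
    ...   | inj₁ (w , w∈ , w≢y , dw) = cover-weaken! 83580 (leaf-cherry U≤m y∈U eq w∈ w≢y dw
              (cover-rescale! 26085 (shrink 2 U≤m (unique₃ w≢y (w≢z w∈) y≢z) (sub₃ w∈) ≤-refl)))
      where open Leaf U≤m y∈U eq
    ...   | inj₂ high = cover-weaken! 83580 (leaf-no-cherry U≤m y∈U eq high
              (cover-rescale! 40825 (shrink 1 U≤m (unique₂ y≢z) sub₂ ≤-refl)))
      where open Leaf U≤m y∈U eq

    -- Without a cherry, `y₂` survives the deletion of `y₁` and its neighbour, and `low-cover`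
    -- improves 0.40825 to 0.34125. With a cherry, `y₂` may be the second leaf and nothing is
    -- gained, so the cherry value 0.26085 + 0.52175 decides.
    low-cover₂ : ∀ {U y₁ y₂} → ∣ U ∣ ≤ m → Low U y₁ → Low U y₂ → y₁ ≢ y₂ → ¬ Adj G y₁ y₂ →
      Covered (MaxIn G U) 78265 0 ∣ U ∣
    low-cover₂ {U} {y} {y₂} U≤m (low y∈U d) l₂ y≢y₂ y≁y₂ with low-neighbours {U} d
    ... | inj₁ eq = cover-weaken! 78265 (isolated-cover U≤m y∈U eq)
    ... | inj₂ (z , eq) with cherry? U y z
    ...   | inj₁ (w , w∈ , w≢y , dw) = cover-weaken! 78265 (leaf-cherry U≤m y∈U eq w∈ w≢y dw
              (cover-rescale! 26085 (shrink 2 U≤m (unique₃ w≢y (w≢z w∈) y≢z) (sub₃ w∈) ≤-refl)))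
      where open Leaf U≤m y∈U eq
    ...   | inj₂ high = cover-weaken! 78265 (leaf-no-cherry U≤m y∈U eq high
              (cover-rescale! 34125 (lift 2 (low-cover (∖-≤ {U} (y ∷ z ∷ []) U≤m) (low-∖ (y ∷ z ∷ []) l₂ y₂∉)) (unique₂ y≢z) sub₂ ≤-refl)))
      where
      open Leaf U≤m y∈U eq
      y₂∉ : y₂ ∉ˡ y ∷ z ∷ []
      y₂∉ (here refl) = y≢y₂ refl
      y₂∉ (there (here refl)) = y≁y₂ (proj₂ (nb⁻ z∈))

    -- Now a low vertex is left in both cases: one after a cherry, two otherwise. The latter is the
    -- worse, with 0.78265 · 0.40825 + 0.42755.
    low-cover₃ : ∀ {U y₁ y₂ y₃} → ∣ U ∣ ≤ m → Low U y₁ → Low U y₂ → Low U y₃ → y₁ ≢ y₂ → y₁ ≢ y₃ → y₂ ≢ y₃ →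
      ¬ Adj G y₁ y₂ → ¬ Adj G y₁ y₃ → ¬ Adj G y₂ y₃ → Covered (MaxIn G U) 74715 0 ∣ U ∣
    low-cover₃ {U} {y} {y₂} {y₃} U≤m (low y∈U d) l₂ l₃ y≢y₂ y≢y₃ y₂≢y₃ y≁y₂ y≁y₃ y₂≁y₃ with low-neighbours {U} d
    ... | inj₁ eq = cover-weaken! 74715 (isolated-cover U≤m y∈U eq)
    ... | inj₂ (z , eq) with cherry? U y z
    ...   | inj₁ (w , w∈ , w≢y , dw) = cover-weaken! 74715 (leaf-cherry U≤m y∈U eq w∈ w≢y dw
              (cover-rescale! 21805 (lift 3 rest (unique₃ w≢y (w≢z w∈) y≢z) (sub₃ w∈) ≤-refl)))
      where
      open Leaf U≤m y∈U eq
      -- w can coincide with at most one of y₂ and y₃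
      rest : Covered (MaxIn G (U ∖ (w ∷ y ∷ z ∷ []))) 83580 0 ∣ U ∖ (w ∷ y ∷ z ∷ []) ∣
      rest with w ≟ᶠ y₂
      ... | yes refl = low-cover (∖-≤ {U} (w ∷ y ∷ z ∷ []) U≤m) (low-∖ (w ∷ y ∷ z ∷ []) l₃
              λ { (here refl) → y₂≢y₃ refl ; (there (here refl)) → y≢y₃ refl ; (there (there (here refl))) → y≁y₃ (proj₂ (nb⁻ z∈)) })
      ... | no w≢y₂ = low-cover (∖-≤ {U} (w ∷ y ∷ z ∷ []) U≤m) (low-∖ (w ∷ y ∷ z ∷ []) l₂
              λ { (here refl) → w≢y₂ refl ; (there (here refl)) → y≢y₂ refl ; (there (there (here refl))) → y≁y₂ (proj₂ (nb⁻ z∈)) })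
    ...   | inj₂ high = cover-weaken! 74715 (leaf-no-cherry U≤m y∈U eq high
              (cover-rescale! 31955 (lift 2 (low-cover₂ (∖-≤ {U} (y ∷ z ∷ []) U≤m) (low-∖ (y ∷ z ∷ []) l₂ y₂∉) (low-∖ (y ∷ z ∷ []) l₃ y₃∉) y₂≢y₃ y₂≁y₃) (unique₂ y≢z) sub₂ ≤-refl)))
      where
      open Leaf U≤m y∈U eq
      y₂∉ : y₂ ∉ˡ y ∷ z ∷ []
      y₂∉ (here refl) = y≢y₂ refl
      y₂∉ (there (here refl)) = y≁y₂ (proj₂ (nb⁻ z∈))
      y₃∉ : y₃ ∉ˡ y ∷ z ∷ []
      y₃∉ (here refl) = y≢y₃ refl
      y₃∉ (there (here refl)) = y≁y₃ (proj₂ (nb⁻ z∈))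

-- 4-cycle components and the case analysis by degrees

sum-const-≤ : ∀ {A : Set} c (xs : List A) {d} → length xs ≤ d → sum (map (λ _ → c) xs) ≤ d * c
sum-const-≤ c xs le = ≤-trans (≤-reflexive (sum-const c xs)) (*-monoˡ-≤ c le)

module Verdicts {n} (G : Graph n) (triangle-free : TriangleFree G) where

  open Neighbourhoods G
  open Estimates G triangle-free

  two-only : ∀ {U v x y u} → deg U v ≤ 2 → x ≢ y → x ∈ˡ nb U v → y ∈ˡ nb U v → u ∈ˡ nb U v → u ≡ x ⊎ u ≡ y
  two-only {U} {v} {x} {y} {u} d x≢y x∈ y∈ u∈ with u ≟ᶠ x | u ≟ᶠ y
  ... | yes p | _ = inj₁ p
  ... | no _ | yes p = inj₂ p
  ... | no u≢x | no u≢y = ⊥-elim (<⇒≱ (≤-trans three d) ≤-refl)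
    where
    three : 3 ≤ deg U v
    three = length-mono-⊆ {xs = u ∷ x ∷ y ∷ []} ((u≢x ∷ u≢y ∷ []) ∷ (x≢y ∷ []) ∷ [] ∷ [])
      λ { (here refl) → u∈ ; (there (here refl)) → x∈ ; (there (there (here refl))) → y∈ }

  two-elements : ∀ {xs : List (Fin n)} → Unique xs → 2 ≤ length xs → ∃[ x ] ∃[ y ] x ∈ˡ xs × y ∈ˡ xs × x ≢ y
  two-elements {x ∷ y ∷ _} ((x≢y ∷ _) ∷ _) _ = x , y , here refl , there (here refl) , x≢y
  two-elements {_ ∷ []} _ (s≤s ())

  another : ∀ {U y} v → 2 ≤ deg U y → ∃[ z ] z ∈ˡ nb U y × z ≢ v
  another {U} {y} v d with two-elements (nb-unique U y) d
  ... | p , q , p∈ , q∈ , p≢q with p ≟ᶠ v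
  ... | yes refl = q , q∈ , λ { refl → p≢q refl }
  ... | no p≢v = p , p∈ , p≢v

  -- A component of G[U] that is the 4-cycle abcd.
  record Square (U : Subset n) : Set where
    field
      a b c d : Fin n
      a∈ : a ∈ U
      b∈ : b ∈ U
      c∈ : c ∈ U
      d∈ : d ∈ U
      distinct : Unique (a ∷ b ∷ c ∷ d ∷ [])
      ab : Adj G a b
      bc : Adj G b c
      cd : Adj G c d
      da : Adj G d a
      nb-a : ∀ {u} → u ∈ˡ nb U a → u ≡ b ⊎ u ≡ d
      nb-b : ∀ {u} → u ∈ˡ nb U b → u ≡ a ⊎ u ≡ c
      nb-c : ∀ {u} → u ∈ˡ nb U c → u ≡ b ⊎ u ≡ d
      nb-d : ∀ {u} → u ∈ˡ nb U d → u ≡ a ⊎ u ≡ c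

    corners : List (Fin n)
    corners = a ∷ b ∷ c ∷ d ∷ []

    corners⊆U : ∀ {r} → r ∈ˡ corners → r ∈ U
    corners⊆U (here refl) = a∈
    corners⊆U (there (here refl)) = b∈
    corners⊆U (there (there (here refl))) = c∈
    corners⊆U (there (there (there (here refl)))) = d∈

    bd-corner : ∀ {u} → u ≡ b ⊎ u ≡ d → u ∈ˡ corners
    bd-corner (inj₁ refl) = there (here refl)
    bd-corner (inj₂ refl) = there (there (there (here refl)))

    ac-corner : ∀ {u} → u ≡ a ⊎ u ≡ c → u ∈ˡ corners
    ac-corner (inj₁ refl) = here refl
    ac-corner (inj₂ refl) = there (there (here refl))

    closed : ∀ {r u} → r ∈ˡ corners → u ∈ˡ nb U r → u ∈ˡ corners
    closed (here refl) i = bd-corner (nb-a i)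
    closed (there (here refl)) i = ac-corner (nb-b i)
    closed (there (there (here refl))) i = bd-corner (nb-c i)
    closed (there (there (there (here refl)))) i = ac-corner (nb-d i)

  module _ {U} (S : Square U) where
    open Square S

    private
      Pair : Fin n → Fin n → Subset n → Set
      Pair x y = Split U (x ∷ y ∷ []) corners

      pair-cover : ∀ {x y w j k} → x ∈ˡ corners → y ∈ˡ corners → Covered (MaxIn G (U ∖ corners)) w j k → Covered (Pair x y) w j k
      pair-cover {x} {y} x∈ y∈ = cover-split A⊆ (λ i → closed (A⊆ i))
        where
        A⊆ : ∀ {r} → r ∈ˡ x ∷ y ∷ [] → r ∈ˡ corners
        A⊆ (here refl) = x∈
        A⊆ (there (here refl)) = y∈

      pattern 1st = here refl
      pattern 2nd = there 1st
      pattern 3rd = there 2nd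
      pattern 4th = there 3rd

    -- Three chosen corners would contain a path with two edges. If at most one corner is chosen,
    -- the middle one of three absent corners has no neighbour in `F` and could be added. So `F`
    -- meets the square in one of its six pairs.
    square-cover : ∀ {w j k} → Covered (MaxIn G (U ∖ corners)) w j k →
      Covered (MaxIn G U) (w + (w + (w + (w + (w + w))))) j k
    square-cover cov = cover-mono
      (cover-∪ (pair-cover 1st 2nd cov) (cover-∪ (pair-cover 1st 3rd cov) (cover-∪ (pair-cover 1st 4th cov)
        (cover-∪ (pair-cover 2nd 3rd cov) (cover-∪ (pair-cover 2nd 4th cov) (pair-cover 3rd 4th cov)))))) cases
      where
      a≢c : a ≢ c
      a≢c with distinct
      ... | (_ ∷ p ∷ _) ∷ _ = p
      b≢d : b ≢ d
      b≢d with distinct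
      ... | _ ∷ (_ ∷ p ∷ _) ∷ _ = p
      cases : ∀ {F} → MaxIn G U F → Pair a b F ⊎ Pair a c F ⊎ Pair a d F ⊎ Pair b c F ⊎ Pair b d F ⊎ Pair c d F
      cases {F} m with a ∈? F | b ∈? F | c ∈? F | d ∈? F
      ... | yes p | yes q | yes r | _ = ⊥-elim (a≢c (diss m q p r (Adj-sym ab) bc))
      ... | yes p | yes q | _ | yes s = ⊥-elim (b≢d (diss m p q s ab (Adj-sym da)))
      ... | yes p | _ | yes r | yes s = ⊥-elim (a≢c (diss m s p r da (Adj-sym cd)))
      ... | _ | yes q | yes r | yes s = ⊥-elim (b≢d (diss m r q s (Adj-sym bc) cd))
      ... | yes p | yes q | no r | no s = inj₁ record { max = m ; chosen = λ { 1st → p ; 2nd → q }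
            ; decided = λ { 1st _ → 1st ; 2nd _ → 2nd ; 3rd i → ⊥-elim (r i) ; 4th i → ⊥-elim (s i) } }
      ... | yes p | no q | yes r | no s = inj₂ (inj₁ record { max = m ; chosen = λ { 1st → p ; 2nd → r }
            ; decided = λ { 1st _ → 1st ; 2nd i → ⊥-elim (q i) ; 3rd _ → 2nd ; 4th i → ⊥-elim (s i) } })
      ... | yes p | no q | no r | yes s = inj₂ (inj₂ (inj₁ record { max = m ; chosen = λ { 1st → p ; 2nd → s }
            ; decided = λ { 1st _ → 1st ; 2nd i → ⊥-elim (q i) ; 3rd i → ⊥-elim (r i) ; 4th _ → 2nd } }))
      ... | no p | yes q | yes r | no s = inj₂ (inj₂ (inj₂ (inj₁ record { max = m ; chosen = λ { 1st → q ; 2nd → r }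
            ; decided = λ { 1st i → ⊥-elim (p i) ; 2nd _ → 1st ; 3rd _ → 2nd ; 4th i → ⊥-elim (s i) } })))
      ... | no p | yes q | no r | yes s = inj₂ (inj₂ (inj₂ (inj₂ (inj₁ record { max = m ; chosen = λ { 1st → q ; 2nd → s }
            ; decided = λ { 1st i → ⊥-elim (p i) ; 2nd _ → 1st ; 3rd i → ⊥-elim (r i) ; 4th _ → 2nd } }))))
      ... | no p | no q | yes r | yes s = inj₂ (inj₂ (inj₂ (inj₂ (inj₂ record { max = m ; chosen = λ { 1st → r ; 2nd → s }
            ; decided = λ { 1st i → ⊥-elim (p i) ; 2nd i → ⊥-elim (q i) ; 3rd _ → 1st ; 4th _ → 2nd } }))))
      ... | no p | no q | _ | no s = ⊥-elim (p (addable-isolated m a∈ λ u∈F au →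
            [ (λ { refl → q u∈F }) , (λ { refl → s u∈F }) ]′ (nb-a (nb⁺ (sub m u∈F) au))))
      ... | no p | no q | no r | _ = ⊥-elim (q (addable-isolated m b∈ λ u∈F au →
            [ (λ { refl → p u∈F }) , (λ { refl → r u∈F }) ]′ (nb-b (nb⁺ (sub m u∈F) au))))
      ... | _ | no q | no r | no s = ⊥-elim (r (addable-isolated m c∈ λ u∈F au →
            [ (λ { refl → q u∈F }) , (λ { refl → s u∈F }) ]′ (nb-c (nb⁺ (sub m u∈F) au))))
      ... | no p | _ | no r | no s = ⊥-elim (s (addable-isolated m d∈ λ u∈F au →
            [ (λ { refl → p u∈F }) , (λ { refl → r u∈F }) ]′ (nb-d (nb⁺ (sub m u∈F) au))))

  module Cases (m : ℕ) (hyp : ∀ W → ∣ W ∣ < m → Covered (MaxIn G W) D 0 ∣ W ∣) where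
    open Induction m hyp

    singleton-unique : ∀ {x : Fin n} → Unique (x ∷ [])
    singleton-unique = [] ∷ []

    singleton-sub : ∀ {U : Subset n} {x} → x ∈ U → ∀ {r} → r ∈ˡ x ∷ [] → r ∈ U
    singleton-sub x∈U (here refl) = x∈U

    low-after-removal : ∀ {U x y} → x ∈ U → y ∈ˡ nb U x → deg U y ≤ 2 → Low (U ∖ (x ∷ [])) y
    low-after-removal {U} {x} x∈U y∈ d = low
      (∈-∖⁺ (x ∷ []) (proj₁ (nb⁻ y∈)) λ { (here refl) → nb-∌ y∈ })
      (≤-pred (≤-trans (deg-∖-< (x ∷ []) (nb-sym x∈U y∈) (here refl)) d))

    module Mixed {U x} (U≤m : ∣ U ∣ ≤ m) (x∈U : x ∈ U) (min-deg : ∀ {v} → v ∈ U → 2 ≤ deg U v) (3≤deg : 3 ≤ deg U x) where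

      W : Subset n
      W = U ∖ (x ∷ [])

      W≤m : ∣ W ∣ ≤ m
      W≤m = ∖-≤ {U} (x ∷ []) U≤m

      alone : Covered (MaxIn G (U ∖ (x ∷ nb U x))) 16667 0 ∣ U ∣
      alone = cover-rescale! 16667 (alone-cover 3 U≤m x∈U 3≤deg)

      -- Matching `x` with `y` deletes at least 3 + 2 vertices, or 3 + 3 if `y` has degree three or
      -- more; the values bound α^(-5) and α^(-6).
      weightOf : ∀ {y} → Dec (deg U y ≤ 2) → ℕ
      weightOf d = if does d then 10651 else 6805

      weight : Fin n → ℕ
      weight y = weightOf (deg U y ≤? 2)

      weightOf≤ : ∀ {y} (d : Dec (deg U y ≤ 2)) → weightOf d ≤ 10651
      weightOf≤ (yes _) = evaluated
      weightOf≤ (no _) = evaluated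

      weightOf-high : ∀ {y} (d : Dec (deg U y ≤ 2)) → ¬ (deg U y ≤ 2) → weightOf d ≤ 6805
      weightOf-high (yes d) ¬d = ⊥-elim (¬d d)
      weightOf-high (no _) _ = evaluated

      weight≤ : ∀ y → weight y ≤ 10651
      weight≤ y = weightOf≤ (deg U y ≤? 2)

      weight-high : ∀ {y} → ¬ (deg U y ≤ 2) → weight y ≤ 6805
      weight-high {y} = weightOf-high (deg U y ≤? 2)

      eachOf : ∀ {y} (d : Dec (deg U y ≤ 2)) → y ∈ˡ nb U x → Covered (Matched U x y) (weightOf d) 0 ∣ U ∣
      eachOf (yes _) y∈ = cover-rescale! 10651 (match-cover 4 U≤m x∈U y∈ (+-mono-≤ 3≤deg (min-deg (proj₁ (nb⁻ y∈)))))
      eachOf (no ¬d) y∈ = cover-rescale! 6805 (match-cover 5 U≤m x∈U y∈ (+-mono-≤ 3≤deg (≰⇒> ¬d)))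

      each : ∀ {y} → y ∈ˡ nb U x → Covered (Matched U x y) (weight y) 0 ∣ U ∣
      each {y} = eachOf (deg U y ≤? 2)

      some : Covered (SomeMatch U x) (sum (map weight (nb U x))) 0 ∣ U ∣
      some = cover-Σ (nb U x) each

      weight-sum : ∀ {y₁ y₂ y₃} a b c → nb U x ≡ y₁ ∷ y₂ ∷ y₃ ∷ [] → weight y₁ ≤ a → weight y₂ ≤ b → weight y₃ ≤ c →
        sum (map weight (nb U x)) ≤ a + (b + (c + 0))
      weight-sum a b c eq p q r = subst (λ l → sum (map weight l) ≤ a + (b + (c + 0))) (≡-sym eq)
        (+-mono-≤ p (+-mono-≤ q (+-mono-≤ r ≤-refl)))

      -- Three neighbours of degree two would give 0.53405 + 0.16667 + 3 · 0.10651 > 1. But then all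
      -- three are low after `x` is deleted, and pairwise nonadjacent, so `low-cover₃` lowers the
      -- first term to 0.47740. If some neighbour has higher degree, its smaller weight suffices.
      mixed-cover₃ : ∀ {y₁ y₂ y₃} → nb U x ≡ y₁ ∷ y₂ ∷ y₃ ∷ [] →
        Covered (MaxIn G W) 53405 0 ∣ U ∣ → Covered (MaxIn G U) 98185 0 ∣ U ∣
      mixed-cover₃ {y₁} {y₂} {y₃} eq out with deg U y₁ ≤? 2 | deg U y₂ ≤? 2 | deg U y₃ ≤? 2
      ... | yes d₁ | yes d₂ | yes d₃ = cover-weaken! 98185 (branch
              (cover-rescale! 47740 (lift 1 (low-cover₃ W≤m (lo y₁∈ d₁) (lo y₂∈ d₂) (lo y₃∈ d₃) y₁≢y₂ y₁≢y₃ y₂≢y₃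
                 (nonadj y₁∈ y₂∈) (nonadj y₁∈ y₃∈) (nonadj y₂∈ y₃∈)) singleton-unique (singleton-sub x∈U) ≤-refl))
              alone (cover-weaken (weight-sum 10651 10651 10651 eq (weight≤ y₁) (weight≤ y₂) (weight≤ y₃)) some))
        where
        lo : ∀ {y} → y ∈ˡ nb U x → deg U y ≤ 2 → Low W y
        lo = low-after-removal x∈U
        nonadj : ∀ {y z} → y ∈ˡ nb U x → z ∈ˡ nb U x → ¬ Adj G y z
        nonadj y∈ z∈ a = nb-disjoint y∈ z∈ (nb⁺ {U} (proj₁ (nb⁻ z∈)) a)
        y₁∈ : y₁ ∈ˡ nb U x
        y₁∈ = subst (y₁ ∈ˡ_) (≡-sym eq) (here refl)
        y₂∈ : y₂ ∈ˡ nb U x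
        y₂∈ = subst (y₂ ∈ˡ_) (≡-sym eq) (there (here refl))
        y₃∈ : y₃ ∈ˡ nb U x
        y₃∈ = subst (y₃ ∈ˡ_) (≡-sym eq) (there (there (here refl)))
        uniq : Unique (y₁ ∷ y₂ ∷ y₃ ∷ [])
        uniq = subst Unique eq (nb-unique U x)
        y₁≢y₂ : y₁ ≢ y₂
        y₁≢y₂ with uniq
        ... | (p ∷ _) ∷ _ = p
        y₁≢y₃ : y₁ ≢ y₃
        y₁≢y₃ with uniq
        ... | (_ ∷ p ∷ _) ∷ _ = p
        y₂≢y₃ : y₂ ≢ y₃
        y₂≢y₃ with uniq
        ... | _ ∷ (p ∷ _) ∷ _ = p
      ... | no h₁ | _ | _ = cover-weaken! 98185 (branch out alone (cover-weaken (weight-sum 6805 10651 10651 eq (weight-high h₁) (weight≤ y₂) (weight≤ y₃)) some))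
      ... | yes _ | no h₂ | _ = cover-weaken! 98185 (branch out alone (cover-weaken (weight-sum 10651 6805 10651 eq (weight≤ y₁) (weight-high h₂) (weight≤ y₃)) some))
      ... | yes _ | yes _ | no h₃ = cover-weaken! 98185 (branch out alone (cover-weaken (weight-sum 10651 10651 6805 eq (weight≤ y₁) (weight≤ y₂) (weight-high h₃)) some))

      mixed-cover : ∀ {y} → y ∈ˡ nb U x → deg U y ≤ 2 → Covered (MaxIn G U) 98185 0 ∣ U ∣
      mixed-cover {y} y∈ d with 4 ≤? deg U x
      -- The matchings of `x` now cost at most 4α^(-6) < 0.27220, whatever the degrees of its
      -- neighbours beyond two.
      ... | yes 4≤deg = cover-weaken! 98185 (branch out alone
              (some-match-cover 2 4 27220 U≤m x∈U (λ i → min-deg (proj₁ (nb⁻ i))) (s≤s (s≤s z≤n)) 4≤deg))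
        where
        out : Covered (MaxIn G W) 53405 0 ∣ U ∣
        out = cover-rescale! 53405 (lift 1 (low-cover W≤m (low-after-removal x∈U y∈ d)) singleton-unique (singleton-sub x∈U) ≤-refl)
      ... | no ¬4≤deg with three-elements (nb U x) 3≤deg (≤-pred (≰⇒> ¬4≤deg))
        where
        three-elements : ∀ (xs : List (Fin n)) → 3 ≤ length xs → length xs ≤ 3 → ∃[ a ] ∃[ b ] ∃[ c ] xs ≡ a ∷ b ∷ c ∷ []
        three-elements (a ∷ b ∷ c ∷ []) _ _ = a , b , c , refl
        three-elements (_ ∷ []) (s≤s ()) _
        three-elements (_ ∷ _ ∷ []) (s≤s (s≤s ())) _
        three-elements (_ ∷ _ ∷ _ ∷ _ ∷ _) _ (s≤s (s≤s (s≤s ())))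
      ... | _ , _ , _ , eq = mixed-cover₃ eq
              (cover-rescale! 53405 (lift 1 (low-cover W≤m (low-after-removal x∈U y∈ d)) singleton-unique (singleton-sub x∈U) ≤-refl))

    -- z₁ y₁ v y₂ z₂ is a path all of whose vertices have degree two.
    cycle-cover : ∀ {U v y₁ y₂ z₁ z₂} → ∣ U ∣ ≤ m → v ∈ U → (∀ {u} → u ∈ U → 2 ≤ deg U u) → deg U v ≤ 2 →
      y₁ ∈ˡ nb U v → y₂ ∈ˡ nb U v → y₁ ≢ y₂ → deg U y₁ ≤ 2 → deg U y₂ ≤ 2 →
      z₁ ∈ˡ nb U y₁ → z₂ ∈ˡ nb U y₂ → z₁ ≢ v → z₂ ≢ v → z₁ ≢ z₂ → deg U z₁ ≤ 2 → deg U z₂ ≤ 2 →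
      Covered (MaxIn G U) 99700 0 ∣ U ∣
    cycle-cover {U} {v} {y₁} {y₂} {z₁} {z₂} U≤m v∈U min-deg dv y₁∈ y₂∈ y₁≢y₂ dy₁ dy₂ z₁∈ z₂∈ z₁≢v z₂≢v z₁≢z₂ dz₁ dz₂ =
      -- The total is 0.50010 + 0.21805 + 2 · 0.13932 = 0.99679; each of the three terms uses a low
      -- vertex left by its deletion.
      cover-weaken! 99700 (branch out alone (cover-weaken (sum-const-≤ 13932 (nb U v) dv) (cover-Σ (nb U v) each)))
      where
      out : Covered (MaxIn G (U ∖ (v ∷ []))) 50010 0 ∣ U ∣
      out = cover-rescale! 50010 (lift 1 (low-cover₂ (∖-≤ {U} (v ∷ []) U≤m) (low-after-removal v∈U y₁∈ dy₁) (low-after-removal v∈U y₂∈ dy₂)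
        y₁≢y₂ (λ a → nb-disjoint y₁∈ y₂∈ (nb⁺ {U} (proj₁ (nb⁻ y₂∈)) a))) singleton-unique (singleton-sub v∈U) ≤-refl)
      low-end : ∀ {y z} R → y ∈ˡ nb U v → z ∈ˡ nb U y → deg U z ≤ 2 → y ∈ˡ R → z ∉ˡ R → Low (U ∖ R) z
      low-end R y∈ z∈ dz y∈R z∉R = low (∈-∖⁺ R (proj₁ (nb⁻ z∈)) z∉R)
        (≤-pred (≤-trans (deg-∖-< R (nb-sym (proj₁ (nb⁻ y∈)) z∈) y∈R) dz))
      -- Here `z₁` has lost its neighbour `y₁`; it is not deleted itself, as a neighbour of `v` it
      -- would complete a triangle.
      alone : Covered (MaxIn G (U ∖ (v ∷ nb U v))) 21805 0 ∣ U ∣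
      alone = cover-rescale! 21805 (lift 3 (low-cover (∖-≤ {U} (v ∷ nb U v) U≤m) (low-end (v ∷ nb U v) y₁∈ z₁∈ dz₁ (there y₁∈)
        λ { (here p) → z₁≢v p ; (there i) → nb-disjoint y₁∈ i z₁∈ })) (nb-unique⁺ U v) (nb-sub⁺ v∈U) (s≤s (min-deg v∈U)))
      matched-cover : ∀ {y y′ z z′} → y ∈ˡ nb U v → y′ ∈ˡ nb U v → z ∈ˡ nb U y → z′ ∈ˡ nb U y′ →
        z ≢ v → z′ ≢ v → z ≢ z′ → deg U y ≤ 2 → deg U z′ ≤ 2 → Covered (Matched U v y) 13932 0 ∣ U ∣
      matched-cover {y} {y′} {z} {z′} y∈ y′∈ z∈ z′∈ z≢v z′≢v z≢z′ dy dz′ = cover-matched v∈U y∈ (cover-rescale! 13932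
        (lift 4 (low-cover (∖-≤ {U} R U≤m) (low-end R y′∈ z′∈ dz′ (∈-++⁺ˡ y′∈) z′∉)) (nb-++-unique y∈) (nb-++-sub {U} {v} {y})
          (subst (4 ≤_) (≡-sym (length-++ (nb U v))) (+-mono-≤ (min-deg v∈U) (min-deg (proj₁ (nb⁻ y∈)))))))
        where
        R = nb U v ++ nb U y
        z′∉ : z′ ∉ˡ R
        z′∉ i with ∈-++⁻ (nb U v) i
        -- The low vertex `z′` must survive: it is no neighbour of `v`, by triangle-freeness, and
        -- the only neighbours of `y` are `v` and `z`. In a 4-cycle `z` and `z′` coincide and this
        -- gain disappears.
        ... | inj₁ j = nb-disjoint y′∈ j z′∈
        ... | inj₂ j with two-only dy z≢v z∈ (nb-sym v∈U y∈) j
        ...   | inj₁ p = z≢z′ (≡-sym p)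
        ...   | inj₂ p = z′≢v p
      each : ∀ {y} → y ∈ˡ nb U v → Covered (Matched U v y) 13932 0 ∣ U ∣
      each y∈ with two-only dv y₁≢y₂ y₁∈ y₂∈ y∈
      ... | inj₁ refl = matched-cover y₁∈ y₂∈ z₁∈ z₂∈ z₁≢v z₂≢v z₁≢z₂ dy₁ dz₂
      ... | inj₂ refl = matched-cover y₂∈ y₁∈ z₂∈ z₁∈ z₂≢v z₁≢v (z₁≢z₂ ∘ ≡-sym) dy₂ dz₁

    -- By the last hypothesis the component of `v` is a cycle. Following it two steps from `v` in
    -- both directions, the ends `z₁` and `z₂` coincide exactly when the cycle is a C4.
    degree-two-component : ∀ {U v} → ∣ U ∣ ≤ m → v ∈ U → (∀ {u} → u ∈ U → 2 ≤ deg U u) → deg U v ≤ 2 →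
      (∀ {y u} → y ∈ U → deg U y ≤ 2 → u ∈ˡ nb U y → deg U u ≤ 2) → Covered (MaxIn G U) 99900 0 ∣ U ∣ ⊎ Square U
    degree-two-component {U} {v} U≤m v∈U min-deg dv spread with two-elements (nb-unique U v) (min-deg v∈U)
    ... | y₁ , y₂ , y₁∈ , y₂∈ , y₁≢y₂ with another v (min-deg (proj₁ (nb⁻ y₁∈))) | another v (min-deg (proj₁ (nb⁻ y₂∈)))
    ... | z₁ , z₁∈ , z₁≢v | z₂ , z₂∈ , z₂≢v with z₁ ≟ᶠ z₂
    ... | no z₁≢z₂ = inj₁ (cover-weaken! 99900 (cycle-cover U≤m v∈U min-deg dv y₁∈ y₂∈ y₁≢y₂ dy₁ dy₂ z₁∈ z₂∈ z₁≢v z₂≢v z₁≢z₂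
            (spread (proj₁ (nb⁻ y₁∈)) dy₁ z₁∈) (spread (proj₁ (nb⁻ y₂∈)) dy₂ z₂∈)))
      where
      dy₁ : deg U y₁ ≤ 2
      dy₁ = spread v∈U dv y₁∈
      dy₂ : deg U y₂ ≤ 2
      dy₂ = spread v∈U dv y₂∈
    ... | yes refl = inj₂ record
      { a = v ; b = y₁ ; c = z₁ ; d = y₂
      ; a∈ = v∈U ; b∈ = y₁∈U ; c∈ = proj₁ (nb⁻ z₁∈) ; d∈ = y₂∈U
      ; distinct = (v≢ y₁∈ ∷ z₁≢v ∘ ≡-sym ∷ v≢ y₂∈ ∷ []) ∷ (v≢ z₁∈ ∷ y₁≢y₂ ∷ []) ∷ ((v≢ z₂∈ ∘ ≡-sym) ∷ []) ∷ [] ∷ []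
      ; ab = proj₂ (nb⁻ y₁∈) ; bc = proj₂ (nb⁻ z₁∈) ; cd = Adj-sym (proj₂ (nb⁻ z₂∈)) ; da = Adj-sym (proj₂ (nb⁻ y₂∈))
      ; nb-a = two-only dv y₁≢y₂ y₁∈ y₂∈
      ; nb-b = two-only dy₁ (z₁≢v ∘ ≡-sym) (nb-sym v∈U y₁∈) z₁∈
      ; nb-c = two-only (spread y₁∈U dy₁ z₁∈) y₁≢y₂ (nb-sym y₁∈U z₁∈) (nb-sym y₂∈U z₂∈)
      ; nb-d = two-only dy₂ (z₁≢v ∘ ≡-sym) (nb-sym v∈U y₂∈) z₂∈
      }
      where
      y₁∈U : y₁ ∈ U
      y₁∈U = proj₁ (nb⁻ y₁∈)
      y₂∈U : y₂ ∈ U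
      y₂∈U = proj₁ (nb⁻ y₂∈)
      dy₁ : deg U y₁ ≤ 2
      dy₁ = spread v∈U dv y₁∈
      dy₂ : deg U y₂ ≤ 2
      dy₂ = spread v∈U dv y₂∈
      v≢ : ∀ {x y} → y ∈ˡ nb U x → x ≢ y
      v≢ i refl = nb-∌ i

    -- Degree four is enough for the plain bounds: 0.63894 + 0.16667 + 4 · 0.04347 < 0.98.
    dense-cover : ∀ {U x} → ∣ U ∣ ≤ m → x ∈ U → (∀ {u} → u ∈ U → 3 ≤ deg U u) → 4 ≤ deg U x → Covered (MaxIn G U) 99900 0 ∣ U ∣
    dense-cover {U} {x} U≤m x∈U min-deg 4≤deg = cover-weaken! 99900 (branch
      (cover-rescale! 63895 (shrink 0 U≤m singleton-unique (singleton-sub x∈U) ≤-refl))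
      (cover-rescale! 16667 (alone-cover 3 U≤m x∈U (min-deg x∈U)))
      (some-match-cover 3 4 17393 U≤m x∈U (λ i → min-deg (proj₁ (nb⁻ i))) (s≤s (s≤s z≤n)) 4≤deg))

    -- After deleting x, a neighbour y of x has degree two while another neighbour z of y keeps its degree three.
    cubic-cover : ∀ {U x} → ∣ U ∣ ≤ m → x ∈ U → (∀ {u} → u ∈ U → 3 ≤ deg U u) → (∀ {u} → u ∈ U → deg U u ≤ 3) →
      Covered (MaxIn G U) 99900 0 ∣ U ∣
    cubic-cover {U} {x} U≤m x∈U min-deg max-deg with two-elements (nb-unique U x) (≤-trans (n≤1+n 2) (min-deg x∈U))
    ... | y , _ , y∈ , _ with another x (≤-trans (n≤1+n 2) (min-deg (proj₁ (nb⁻ y∈))))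
    ... | z , z∈ , z≢x = cover-weaken! 99900 (branch
      -- The factor 0.98185 for U - x lowers the total from about 1.0097 to below 0.9982.
      (cover-rescale! 62735 (lift 1 rest singleton-unique (singleton-sub x∈U) ≤-refl))
      (cover-rescale! 16667 (alone-cover 3 U≤m x∈U (min-deg x∈U)))
      (some-match-cover 3 3 20415 U≤m x∈U (λ i → min-deg (proj₁ (nb⁻ i))) (s≤s (s≤s z≤n)) (min-deg x∈U)))
      where
      W = U ∖ (x ∷ [])
      y∈U : y ∈ U
      y∈U = proj₁ (nb⁻ y∈)
      -- Otherwise `x`, `y` and `z` would form a triangle.
      x∉nbz : x ∉ˡ nb U z
      x∉nbz i = nb-disjoint y∈ (nb-sym (proj₁ (nb⁻ z∈)) i) z∈
      y∉ : y ∉ˡ x ∷ []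
      y∉ (here refl) = nb-∌ y∈
      rest : Covered (MaxIn G W) 98185 0 ∣ W ∣
      rest = Mixed.mixed-cover (∖-≤ {U} (x ∷ []) U≤m) (∈-∖⁺ (x ∷ []) (proj₁ (nb⁻ z∈)) (λ { (here p) → z≢x p }))
        (λ v∈ → ≤-pred (≤-trans (min-deg (proj₁ (∈-∖⁻ (x ∷ []) v∈))) (deg-minus x)))
        (≤-trans (min-deg (proj₁ (nb⁻ z∈))) (deg-minus-nonadj x x∉nbz))
        (nb-∖⁺ (x ∷ []) (nb-sym y∈U z∈) y∉)
        (≤-pred (≤-trans (deg-∖-< (x ∷ []) (nb-sym x∈U y∈) (here refl)) (max-deg y∈U)))

    -- Each failed test supplies a hypothesis for the later ones: no low vertex gives minimum degree
    -- two, no mixed edge makes degree two spread along edges, no vertex of degree two gives minimum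
    -- degree three, and no vertex of degree four leaves a cubic graph.
    step : ∀ U → ∣ U ∣ ≤ m → (∀ {v} → v ∉ U) ⊎ Covered (MaxIn G U) 99900 0 ∣ U ∣ ⊎ Square U
    step U U≤m with any? (λ v → v ∈? U ×-dec deg U v ≤? 1)
    ... | yes (v , v∈U , d) = inj₂ (inj₁ (cover-weaken! 99900 (low-cover U≤m (low v∈U d))))
    ... | no ¬low with any? (λ x → x ∈? U ×-dec 3 ≤? deg U x ×-dec Any.any? (λ y → deg U y ≤? 2) (nb U x))
    ...   | yes (x , x∈U , 3≤deg , p) with find p
    ...     | y , y∈ , d = inj₂ (inj₁ (cover-weaken! 99900 (Mixed.mixed-cover U≤m x∈U (λ v∈U → ≰⇒> λ le → ¬low (_ , v∈U , le)) 3≤deg y∈ d)))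
    step U U≤m | no ¬low | no ¬mixed with any? (λ v → v ∈? U ×-dec deg U v ≤? 2)
    ...   | yes (v , v∈U , d) = inj₂ (degree-two-component U≤m v∈U (λ v∈U → ≰⇒> λ le → ¬low (_ , v∈U , le)) d spread)
      where
      spread : ∀ {y u} → y ∈ U → deg U y ≤ 2 → u ∈ˡ nb U y → deg U u ≤ 2
      spread {y} {u} y∈U dy u∈ = ≮⇒≥ λ 3≤deg → ¬mixed (u , proj₁ (nb⁻ u∈) , 3≤deg , Any.map (λ { refl → dy }) (nb-sym y∈U u∈))
    ...   | no ¬two with any? (λ x → x ∈? U ×-dec 4 ≤? deg U x)
    ...     | yes (x , x∈U , 4≤deg) = inj₂ (inj₁ (dense-cover U≤m x∈U (λ v∈U → ≰⇒> λ le → ¬two (_ , v∈U , le)) 4≤deg))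
    ...     | no ¬four with nonempty? U
    ...       | no empty = inj₁ λ v∈U → empty (_ , v∈U)
    ...       | yes (x , x∈U) = inj₂ (inj₁ (cubic-cover U≤m x∈U (λ v∈U → ≰⇒> λ le → ¬two (_ , v∈U , le))
                  (λ v∈U → ≮⇒≥ λ lt → ¬four (_ , v∈U , lt))))

  -- Induction on the number of vertices

  data Squares : Subset n → ℕ → Set where
    empty : ∀ {U} → (∀ {v} → v ∉ U) → Squares U 0
    _∷_   : ∀ {U k} (S : Square U) → Squares (U ∖ Square.corners S) k → Squares U (suc k)

  data Verdict (U : Subset n) : Set where
    strict : Covered (MaxIn G U) 99900 0 ∣ U ∣ → Verdict U
    tight  : ∀ {k} → Squares U k → Covered (MaxIn G U) D 0 ∣ U ∣ → Verdict U

  verdict⇒cover : ∀ {U} → Verdict U → Covered (MaxIn G U) D 0 ∣ U ∣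
  verdict⇒cover (strict cov) = cover-weaken! D cov
  verdict⇒cover (tight _ cov) = cov

  scale-mono : ∀ a b j k → a ≤ b → j ≤ k → a * 6 ^ j ≤ b * 6 ^ k
  scale-mono a b j k a≤b j≤k = *-mono-≤ a≤b (^-monoʳ-≤ 6 j≤k)

  empty-cover : ∀ {U} → (∀ {v} → v ∉ U) → Covered (MaxIn G U) D 0 ∣ U ∣
  empty-cover {U} none = covered (∅ ∷ []) (scale-mono ((D * 1) ^ 4) (D ^ 4) 0 ∣ U ∣ evaluated z≤n)
    λ m → here (⊆-antisym (λ p → ⊥-elim (none (sub m p))) (⊥⊆))

  -- Removing a square multiplies the number of sets by 6 and deletes four vertices. Since (6w)^4 =
  -- w^4 · 6^4, the constant w of the remainder is inherited unchanged, whether it is 0.999 or 1.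
  verdict : ∀ m U → ∣ U ∣ < m → Verdict U
  verdict (suc m) U (s≤s U≤m) with Cases.step m (λ W lt → verdict⇒cover (verdict m W lt)) U U≤m
  ... | inj₁ none = tight (empty none) (empty-cover none)
  ... | inj₂ (inj₁ cov) = strict cov
  ... | inj₂ (inj₂ S) with verdict m (U ∖ Square.corners S) (begin-strict
          ∣ U ∖ corners ∣       <⟨ m<m+n ∣ U ∖ corners ∣ (s≤s z≤n) ⟩
          ∣ U ∖ corners ∣ + 4   ≤⟨ ∣∖∣ distinct corners⊆U ⟩
          ∣ U ∣                 ≤⟨ U≤m ⟩
          m                     ∎)
    where
    open ≤-Reasoning
    open Square S
  ...   | strict cov = strict (cover-rescale! 99900 (square-cover S (lift 4 cov distinct corners⊆U ≤-refl)))
    where open Square S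
  ...   | tight Ss cov = tight (S ∷ Ss) (cover-rescale! D (square-cover S (lift 4 cov distinct corners⊆U ≤-refl)))
    where open Square S

-- Extremal graphs

T⇒true : ∀ {b} → T b → b ≡ true
T⇒true {true} _ = refl

¬T⇒false : ∀ {b} → ¬ T b → b ≡ false
¬T⇒false {true} ¬t = ⊥-elim (¬t _)
¬T⇒false {false} _ = refl

module Decomposition {n} (G : Graph n) (triangle-free : TriangleFree G) where

  open Neighbourhoods G
  open Verdicts G triangle-free

  module Corner {U} (S : Square U) where
    open Square S

    corner : Fin 4 → Fin n
    corner zero = a
    corner (suc zero) = b
    corner (suc (suc zero)) = c
    corner (suc (suc (suc zero))) = d

    corner∈ : ∀ i → corner i ∈ˡ corners
    corner∈ zero = here refl
    corner∈ (suc zero) = there (here refl)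
    corner∈ (suc (suc zero)) = there (there (here refl))
    corner∈ (suc (suc (suc zero))) = there (there (there (here refl)))

    corner-surjective : ∀ {v} → v ∈ˡ corners → ∃[ i ] corner i ≡ v
    corner-surjective (here refl) = zero , refl
    corner-surjective (there (here refl)) = suc zero , refl
    corner-surjective (there (there (here refl))) = suc (suc zero) , refl
    corner-surjective (there (there (there (here refl)))) = suc (suc (suc zero)) , refl

    a≢b : a ≢ b
    a≢b = All.lookup (AllPairs.head distinct) (here refl)
    a≢c : a ≢ c
    a≢c = All.lookup (AllPairs.head distinct) (there (here refl))
    a≢d : a ≢ d
    a≢d = All.lookup (AllPairs.head distinct) (there (there (here refl)))
    b≢c : b ≢ c
    b≢c = All.lookup (AllPairs.head (AllPairs.tail distinct)) (here refl)
    b≢d : b ≢ d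
    b≢d = All.lookup (AllPairs.head (AllPairs.tail distinct)) (there (here refl))
    c≢d : c ≢ d
    c≢d = All.lookup (AllPairs.head (AllPairs.tail (AllPairs.tail distinct))) (here refl)

    a≁c : ¬ Adj G a c
    a≁c e = [ b≢c ∘ ≡-sym , c≢d ]′ (nb-a (nb⁺ c∈ e))
    b≁d : ¬ Adj G b d
    b≁d e = [ a≢d ∘ ≡-sym , c≢d ∘ ≡-sym ]′ (nb-b (nb⁺ d∈ e))

    corner-injective : ∀ i j → corner i ≡ corner j → i ≡ j
    corner-injective zero zero _ = refl
    corner-injective zero (suc zero) e = ⊥-elim (a≢b e)
    corner-injective zero (suc (suc zero)) e = ⊥-elim (a≢c e)
    corner-injective zero (suc (suc (suc zero))) e = ⊥-elim (a≢d e)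
    corner-injective (suc zero) zero e = ⊥-elim (a≢b (≡-sym e))
    corner-injective (suc zero) (suc zero) _ = refl
    corner-injective (suc zero) (suc (suc zero)) e = ⊥-elim (b≢c e)
    corner-injective (suc zero) (suc (suc (suc zero))) e = ⊥-elim (b≢d e)
    corner-injective (suc (suc zero)) zero e = ⊥-elim (a≢c (≡-sym e))
    corner-injective (suc (suc zero)) (suc zero) e = ⊥-elim (b≢c (≡-sym e))
    corner-injective (suc (suc zero)) (suc (suc zero)) _ = refl
    corner-injective (suc (suc zero)) (suc (suc (suc zero))) e = ⊥-elim (c≢d e)
    corner-injective (suc (suc (suc zero))) zero e = ⊥-elim (a≢d (≡-sym e))
    corner-injective (suc (suc (suc zero))) (suc zero) e = ⊥-elim (b≢d (≡-sym e))
    corner-injective (suc (suc (suc zero))) (suc (suc zero)) e = ⊥-elim (c≢d (≡-sym e))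
    corner-injective (suc (suc (suc zero))) (suc (suc (suc zero))) _ = refl

    corner-E : ∀ i j → E G (corner i) (corner j) ≡ c4E i j
    corner-E zero zero = Graph.irrefl G a
    corner-E zero (suc zero) = T⇒true ab
    corner-E zero (suc (suc zero)) = ¬T⇒false a≁c
    corner-E zero (suc (suc (suc zero))) = T⇒true (Adj-sym da)
    corner-E (suc zero) zero = T⇒true (Adj-sym ab)
    corner-E (suc zero) (suc zero) = Graph.irrefl G b
    corner-E (suc zero) (suc (suc zero)) = T⇒true bc
    corner-E (suc zero) (suc (suc (suc zero))) = ¬T⇒false b≁d
    corner-E (suc (suc zero)) zero = ¬T⇒false (a≁c ∘ Adj-sym)
    corner-E (suc (suc zero)) (suc zero) = T⇒true (Adj-sym bc)
    corner-E (suc (suc zero)) (suc (suc zero)) = Graph.irrefl G c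
    corner-E (suc (suc zero)) (suc (suc (suc zero))) = T⇒true cd
    corner-E (suc (suc (suc zero))) zero = T⇒true da
    corner-E (suc (suc (suc zero))) (suc zero) = ¬T⇒false (b≁d ∘ Adj-sym)
    corner-E (suc (suc (suc zero))) (suc (suc zero)) = T⇒true (Adj-sym cd)
    corner-E (suc (suc (suc zero))) (suc (suc (suc zero))) = Graph.irrefl G d

    outside-E : ∀ i {v} → v ∈ U ∖ corners → E G (corner i) v ≡ false
    outside-E i v∈ = ¬T⇒false λ e → let v∈U , v∉ = ∈-∖⁻ corners v∈ in v∉ (closed (corner∈ i) (nb⁺ v∈U e))

  open Corner

  embed : ∀ {U k} → Squares U k → Fin (k * 4) → Fin n
  embed (S ∷ Ss) i = [ corner S , embed Ss ]′ (splitAt 4 i)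

  embed∈ : ∀ {U k} (Ss : Squares U k) i → embed Ss i ∈ U
  embed∈ (S ∷ Ss) i with splitAt 4 i
  ... | inj₁ j = Square.corners⊆U S (corner∈ S j)
  ... | inj₂ j = proj₁ (∈-∖⁻ (Square.corners S) (embed∈ Ss j))

  embed-∉corners : ∀ {U k} (S : Square U) (Ss : Squares (U ∖ Square.corners S) k) j i → corner S j ≢ embed Ss i
  embed-∉corners S Ss j i eq = proj₂ (∈-∖⁻ (Square.corners S) (embed∈ Ss i)) (subst (_∈ˡ Square.corners S) eq (corner∈ S j))

  embed-injective : ∀ {U k} (Ss : Squares U k) {i j} → embed Ss i ≡ embed Ss j → i ≡ j
  embed-injective {k = suc k} (S ∷ Ss) {i} {j} eq = begin
    i                                ≡⟨ join-splitAt 4 (k * 4) i ⟨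
    join 4 (k * 4) (splitAt 4 i)     ≡⟨ cong (join 4 (k * 4)) (inj (splitAt 4 i) (splitAt 4 j) eq) ⟩
    join 4 (k * 4) (splitAt 4 j)     ≡⟨ join-splitAt 4 (k * 4) j ⟩
    j                                ∎
    where
    open ≡-Reasoning
    inj : ∀ x y → [ corner S , embed Ss ]′ x ≡ [ corner S , embed Ss ]′ y → x ≡ y
    inj (inj₁ x) (inj₁ y) e = cong inj₁ (corner-injective S x y e)
    inj (inj₁ x) (inj₂ y) e = ⊥-elim (embed-∉corners S Ss x y e)
    inj (inj₂ x) (inj₁ y) e = ⊥-elim (embed-∉corners S Ss y x (≡-sym e))
    inj (inj₂ x) (inj₂ y) e = cong inj₂ (embed-injective Ss e)

  embed-surjective : ∀ {U k} (Ss : Squares U k) {v} → v ∈ U → ∃[ i ] embed Ss i ≡ v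
  embed-surjective (empty none) v∈ = ⊥-elim (none v∈)
  embed-surjective {k = suc k} (S ∷ Ss) {v} v∈ with Any.any? (v ≟ᶠ_) (Square.corners S)
  ... | yes p with corner-surjective S p
  ...   | i , eq = join 4 (k * 4) (inj₁ i) , trans (cong [ corner S , embed Ss ]′ (splitAt-join 4 (k * 4) (inj₁ i))) eq
  embed-surjective {k = suc k} (S ∷ Ss) {v} v∈ | no v∉ with embed-surjective Ss (∈-∖⁺ (Square.corners S) v∈ v∉)
  ...   | i , eq = join 4 (k * 4) (inj₂ i) , trans (cong [ corner S , embed Ss ]′ (splitAt-join 4 (k * 4) (inj₂ i))) eq

  -- Distinct squares are not joined: all neighbours in `U` of a corner are corners, while the later
  -- squares lie outside the corners.
  embed-E : ∀ {U k} (Ss : Squares U k) i j → E G (embed Ss i) (embed Ss j) ≡ E (C4s k) i j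
  embed-E (S ∷ Ss) i j with splitAt 4 i | splitAt 4 j
  ... | inj₁ x | inj₁ y = corner-E S x y
  ... | inj₁ x | inj₂ y = outside-E S x (embed∈ Ss y)
  ... | inj₂ x | inj₁ y = trans (Graph.sym G _ _) (outside-E S y (embed∈ Ss x))
  ... | inj₂ x | inj₂ y = embed-E Ss x y

  -- Divisibility is a consequence: the squares give a bijection between Fin n and Fin (k * 4),
  -- hence n = 4k.
  squares⇒≅ : ∀ {k} → Squares ⊤ k → (4 ∣ n) × (G ≅ C4s (n / 4))
  squares⇒≅ {k} Ss = divides k n≡k*4 , subst (λ l → G ≅ C4s l) (≡-sym (trans (cong (_/ 4) n≡k*4) (m*n/n≡m k 4))) record
    { bij = ↔⇒⤖ bij
    ; preserve = λ u v → trans (≡-sym (cong₂ (E G) (embed-to u) (embed-to v))) (embed-E Ss (to u) (to v))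
    }
    where
    to : Fin n → Fin (k * 4)
    to v = proj₁ (embed-surjective Ss (∈⊤ {x = v}))
    embed-to : ∀ v → embed Ss (to v) ≡ v
    embed-to v = proj₂ (embed-surjective Ss (∈⊤ {x = v}))
    bij : Fin n ↔ Fin (k * 4)
    bij = mk↔ₛ′ to (embed Ss) (λ i → embed-injective Ss (embed-to (embed Ss i))) embed-to
    n≡k*4 : n ≡ k * 4
    n≡k*4 = ↔⇒≡ bij

-- Counts of subsets as lengths of lists

module _ {ℓ : Level} where

  -- Follows the recursion of `countSubsets`, so that the count becomes the length of a list without
  -- repetitions.
  satisfying : ∀ {n} {P : Subset n → Set ℓ} → Decidable P → List (Subset n)
  satisfying {zero} P? with P? []
  ... | yes _ = [] ∷ []
  ... | no _ = []
  satisfying {suc n} P? = map (inside ∷_) (satisfying (P? ∘ (inside ∷_))) ++ map (outside ∷_) (satisfying (P? ∘ (outside ∷_)))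

  length-satisfying : ∀ {n} {P : Subset n → Set ℓ} (P? : Decidable P) → length (satisfying P?) ≡ countSubsets P?
  length-satisfying {zero} P? with P? []
  ... | yes _ = refl
  ... | no _ = refl
  length-satisfying {suc n} P? = trans (length-++ (map (inside ∷_) (satisfying (P? ∘ (inside ∷_)))))
    (cong₂ _+_ (trans (length-map _ (satisfying (P? ∘ (inside ∷_)))) (length-satisfying (P? ∘ (inside ∷_))))
               (trans (length-map _ (satisfying (P? ∘ (outside ∷_)))) (length-satisfying (P? ∘ (outside ∷_)))))

  ∈-satisfying⁺ : ∀ {n} {P : Subset n → Set ℓ} (P? : Decidable P) {F} → P F → F ∈ˡ satisfying P?
  ∈-satisfying⁺ {zero} P? {[]} p with P? []
  ... | yes _ = here refl
  ... | no ¬p = ⊥-elim (¬p p)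
  ∈-satisfying⁺ {suc n} P? {true ∷ F} p = ∈-++⁺ˡ (∈-map⁺ (inside ∷_) (∈-satisfying⁺ (P? ∘ (inside ∷_)) p))
  ∈-satisfying⁺ {suc n} P? {false ∷ F} p = ∈-++⁺ʳ (map (inside ∷_) (satisfying (P? ∘ (inside ∷_)))) (∈-map⁺ (outside ∷_) (∈-satisfying⁺ (P? ∘ (outside ∷_)) p))

  ∈-satisfying⁻ : ∀ {n} {P : Subset n → Set ℓ} (P? : Decidable P) {F} → F ∈ˡ satisfying P? → P F
  ∈-satisfying⁻ {zero} P? {[]} i with P? [] | i
  ... | yes p | _ = p
  ... | no _ | ()
  ∈-satisfying⁻ {suc n} P? i with ∈-++⁻ (map (inside ∷_) (satisfying (P? ∘ (inside ∷_)))) i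
  ... | inj₁ j with ∈-map⁻ (inside ∷_) j
  ...   | _ , j′ , refl = ∈-satisfying⁻ (P? ∘ (inside ∷_)) j′
  ∈-satisfying⁻ {suc n} P? i | inj₂ j with ∈-map⁻ (outside ∷_) j
  ...   | _ , j′ , refl = ∈-satisfying⁻ (P? ∘ (outside ∷_)) j′

  satisfying-unique : ∀ {n} {P : Subset n → Set ℓ} (P? : Decidable P) → Unique (satisfying P?)
  satisfying-unique {zero} P? with P? []
  ... | yes _ = [] ∷ []
  ... | no _ = []
  satisfying-unique {suc n} P? = Unique.++⁺
    (Unique.map⁺ Vec.∷-injectiveʳ (satisfying-unique (P? ∘ (inside ∷_))))
    (Unique.map⁺ Vec.∷-injectiveʳ (satisfying-unique (P? ∘ (outside ∷_))))
    λ { (i , j) → disjoint i j }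
    where
    disjoint : ∀ {F} {xs ys : List (Subset n)} → F ∈ˡ map (inside ∷_) xs → F ∈ˡ map (outside ∷_) ys → ⊥
    disjoint i j with ∈-map⁻ (inside ∷_) i | ∈-map⁻ (outside ∷_) j
    ... | _ , _ , refl | _ , _ , ()

  -- Only the enumeration has to be free of repetitions; the covering list may be wasteful.
  countSubsets-≤ : ∀ {n} {P : Subset n → Set ℓ} (P? : Decidable P) L → (∀ {F} → P F → F ∈ˡ L) → countSubsets P? ≤ length L
  countSubsets-≤ P? L cov = subst (_≤ length L) (length-satisfying P?)
    (length-mono-⊆ (satisfying-unique P?) (λ i → cov (∈-satisfying⁻ P? i)))

  countSubsets-≥ : ∀ {n} {P : Subset n → Set ℓ} (P? : Decidable P) L → Unique L → (∀ {F} → F ∈ˡ L → P F) → length L ≤ countSubsets P?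
  countSubsets-≥ P? L u sound = subst (length L ≤_) (length-satisfying P?)
    (length-mono-⊆ u (λ i → ∈-satisfying⁺ P? (sound i)))

-- Bounded degree as uniqueness of neighbours

countFin≡0 : ∀ {n} (p : Fin n → Bool) → countFin p ≤ 0 → ∀ u → ¬ T (p u)
countFin≡0 {suc n} p le zero t with p zero
countFin≡0 {suc n} p () zero t | true
countFin≡0 {suc n} p le (suc u) t = countFin≡0 (p ∘ suc) (≤-trans (m≤n+m _ (if p zero then 1 else 0)) le) u t

countFin-none : ∀ {n} (p : Fin n → Bool) → (∀ u → ¬ T (p u)) → countFin p ≤ 0
countFin-none {zero} p _ = z≤n
countFin-none {suc n} p none with p zero | none zero
... | true | ¬t = ⊥-elim (¬t _)
... | false | _ = countFin-none (p ∘ suc) (none ∘ suc)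

countFin≤1⁻ : ∀ {n} (p : Fin n → Bool) → countFin p ≤ 1 → ∀ u w → T (p u) → T (p w) → u ≡ w
countFin≤1⁻ {suc n} p le zero zero _ _ = refl
countFin≤1⁻ {suc n} p le zero (suc w) t s with p zero
... | true = ⊥-elim (countFin≡0 (p ∘ suc) (≤-pred le) w s)
countFin≤1⁻ {suc n} p le (suc u) zero t s with p zero
... | true = ⊥-elim (countFin≡0 (p ∘ suc) (≤-pred le) u t)
countFin≤1⁻ {suc n} p le (suc u) (suc w) t s = cong suc
  (countFin≤1⁻ (p ∘ suc) (≤-trans (m≤n+m _ (if p zero then 1 else 0)) le) u w t s)

countFin≤1⁺ : ∀ {n} (p : Fin n → Bool) → (∀ u w → T (p u) → T (p w) → u ≡ w) → countFin p ≤ 1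
countFin≤1⁺ {zero} p _ = z≤n
countFin≤1⁺ {suc n} p same with p zero in eq
... | true = s≤s (countFin-none (p ∘ suc) λ u t → case (same zero (suc u) (subst T (≡-sym eq) _) t))
  where
  case : ∀ {u : Fin n} → zero ≢ suc u
  case ()
... | false = countFin≤1⁺ (p ∘ suc) λ u w t s → suc-injectiveᶠ (same (suc u) (suc w) t s)

does⁺ : ∀ {A : Set} (d : Dec A) → A → T (does d)
does⁺ (yes _) _ = _
does⁺ (no ¬a) a = ¬a a

does⁻ : ∀ {A : Set} (d : Dec A) → T (does d) → A
does⁻ (yes a) _ = a

module _ {n} (G : Graph n) where

  private
    ∧⁺ : ∀ {v u F} → Adj G v u → u ∈ F → T (E G v u ∧ does (u ∈? F))
    ∧⁺ {v} {u} {F} a u∈ = Equivalence.from Bool.T-∧ (a , does⁺ (u ∈? F) u∈)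
    ∧⁻ : ∀ {v u F} → T (E G v u ∧ does (u ∈? F)) → Adj G v u × u ∈ F
    ∧⁻ {v} {u} {F} t with Equivalence.to (Bool.T-∧ {E G v u}) t
    ... | a , d = a , does⁻ (u ∈? F) d

  dissociated⁺ : ∀ {F} → IsDissociation G F → Dissociated G F
  dissociated⁺ {F} h {v} {u} {w} v∈ u∈ w∈ vu vw =
    countFin≤1⁻ (λ x → E G v x ∧ does (x ∈? F)) (h v v∈) u w (∧⁺ vu u∈) (∧⁺ vw w∈)

  dissociated⁻ : ∀ {F} → Dissociated G F → IsDissociation G F
  dissociated⁻ {F} h v v∈ = countFin≤1⁺ (λ x → E G v x ∧ does (x ∈? F)) λ u w t s →
    let vu , u∈ = ∧⁻ {v} {u} t ; vw , w∈ = ∧⁻ {v} {w} s in h v∈ u∈ w∈ vu vw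

  maxIn⁺ : ∀ {F} → IsMaximalDissociation G F → MaxIn G ⊤ F
  maxIn⁺ {F} (d , m) = record { sub = λ _ → ∈⊤ ; diss = dissociated⁺ d ; maximal = λ {F′} _ d′ F⊆F′ {v} v∈ → case F′ d′ F⊆F′ v v∈ }
    where
    case : ∀ F′ → Dissociated G F′ → F ⊆ F′ → ∀ v → v ∈ F′ → v ∈ F
    case F′ d′ F⊆F′ v v∈ with v ∈? F
    ... | yes p = p
    ... | no ¬p = ⊥-elim (m (F′ , dissociated⁻ d′ , F⊆F′ , v , v∈ , ¬p))

  maxIn⁻ : ∀ {F} → MaxIn G ⊤ F → IsMaximalDissociation G F
  maxIn⁻ m = dissociated⁻ (diss m) , λ { (F′ , d′ , F⊆F′ , v , v∈ , v∉) → v∉ (maximal m (λ _ → ∈⊤) (dissociated⁺ d′) F⊆F′ v∈) }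

-- Maximal sets of disjoint unions

module _ {n m} {G : Graph n} {H : Graph m} where

  private
    ↑ˡ∈⁺ : ∀ {F : Subset n} {K : Subset m} {i} → i ∈ F → (i ↑ˡ m) ∈ F Vec.++ K
    ↑ˡ∈⁺ {F} {K} {i} i∈ = Vec.lookup⇒[]= _ (F Vec.++ K) (trans (Vec.lookup-++ˡ F K i) (Vec.[]=⇒lookup i∈))
    ↑ʳ∈⁺ : ∀ {F : Subset n} {K : Subset m} {i} → i ∈ K → (n ↑ʳ i) ∈ F Vec.++ K
    ↑ʳ∈⁺ {F} {K} {i} i∈ = Vec.lookup⇒[]= _ (F Vec.++ K) (trans (Vec.lookup-++ʳ F K i) (Vec.[]=⇒lookup i∈))
    ↑ˡ∈⁻ : ∀ {F : Subset n} {K : Subset m} {i} → (i ↑ˡ m) ∈ F Vec.++ K → i ∈ F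
    ↑ˡ∈⁻ {F} {K} {i} i∈ = Vec.lookup⇒[]= i F (trans (≡-sym (Vec.lookup-++ˡ F K i)) (Vec.[]=⇒lookup i∈))
    ↑ʳ∈⁻ : ∀ {F : Subset n} {K : Subset m} {i} → (n ↑ʳ i) ∈ F Vec.++ K → i ∈ K
    ↑ʳ∈⁻ {F} {K} {i} i∈ = Vec.lookup⇒[]= i K (trans (≡-sym (Vec.lookup-++ʳ F K i)) (Vec.[]=⇒lookup i∈))

    data View : Fin (n + m) → Set where
      left  : ∀ i → View (i ↑ˡ m)
      right : ∀ i → View (n ↑ʳ i)

    view : ∀ i → View i
    view i = subst View (join-splitAt n m i) (go (splitAt n i))
      where
      go : ∀ x → View (join n m x)
      go (inj₁ x) = left x
      go (inj₂ y) = right y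

    E-ll : ∀ i j → E (G ⊕ H) (i ↑ˡ m) (j ↑ˡ m) ≡ E G i j
    E-ll i j rewrite splitAt-↑ˡ n i m | splitAt-↑ˡ n j m = refl
    E-rr : ∀ i j → E (G ⊕ H) (n ↑ʳ i) (n ↑ʳ j) ≡ E H i j
    E-rr i j rewrite splitAt-↑ʳ n m i | splitAt-↑ʳ n m j = refl
    E-lr : ∀ i j → E (G ⊕ H) (i ↑ˡ m) (n ↑ʳ j) ≡ false
    E-lr i j rewrite splitAt-↑ˡ n i m | splitAt-↑ʳ n m j = refl
    E-rl : ∀ i j → E (G ⊕ H) (n ↑ʳ i) (j ↑ˡ m) ≡ false
    E-rl i j rewrite splitAt-↑ʳ n m i | splitAt-↑ˡ n j m = refl

    diss-⊕ : ∀ {F K} → Dissociated G F → Dissociated H K → Dissociated (G ⊕ H) (F Vec.++ K)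
    diss-⊕ {F} {K} dF dK {v} {u} {w} v∈ u∈ w∈ vu vw with view v | view u | view w
    ... | left i | left j | left l = cong (_↑ˡ m) (dF (↑ˡ∈⁻ v∈) (↑ˡ∈⁻ u∈) (↑ˡ∈⁻ w∈) (subst T (E-ll i j) vu) (subst T (E-ll i l) vw))
    ... | right i | right j | right l = cong (n ↑ʳ_) (dK (↑ʳ∈⁻ {F} v∈) (↑ʳ∈⁻ {F} u∈) (↑ʳ∈⁻ {F} w∈) (subst T (E-rr i j) vu) (subst T (E-rr i l) vw))
    ... | left i | right j | _ = ⊥-elim (subst T (E-lr i j) vu)
    ... | right i | left j | _ = ⊥-elim (subst T (E-rl i j) vu)
    ... | left i | _ | right l = ⊥-elim (subst T (E-lr i l) vw)
    ... | right i | _ | left l = ⊥-elim (subst T (E-rl i l) vw)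

    diss-⊕ˡ : ∀ {F K} → Dissociated (G ⊕ H) (F Vec.++ K) → Dissociated G F
    diss-⊕ˡ d {v} {u} {w} v∈ u∈ w∈ vu vw = ↑ˡ-injective m u w
      (d (↑ˡ∈⁺ v∈) (↑ˡ∈⁺ u∈) (↑ˡ∈⁺ w∈) (subst T (≡-sym (E-ll v u)) vu) (subst T (≡-sym (E-ll v w)) vw))

    diss-⊕ʳ : ∀ {F K} → Dissociated (G ⊕ H) (F Vec.++ K) → Dissociated H K
    diss-⊕ʳ {F} d {v} {u} {w} v∈ u∈ w∈ vu vw = ↑ʳ-injective n u w
      (d (↑ʳ∈⁺ {F} v∈) (↑ʳ∈⁺ {F} u∈) (↑ʳ∈⁺ {F} w∈) (subst T (≡-sym (E-rr v u)) vu) (subst T (≡-sym (E-rr v w)) vw))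

  -- A competitor splits into its parts on the two summands, each a dissociation set of its own
  -- graph, and maximality applies to each part.
  maxIn-⊕ : ∀ {F K} → MaxIn G ⊤ F → MaxIn H ⊤ K → MaxIn (G ⊕ H) ⊤ (F Vec.++ K)
  maxIn-⊕ {F} {K} mF mK = record { sub = λ _ → ∈⊤ ; diss = diss-⊕ (diss mF) (diss mK) ; maximal = λ {F′} _ → max F′ }
    where
    max : ∀ F′ → Dissociated (G ⊕ H) F′ → F Vec.++ K ⊆ F′ → F′ ⊆ F Vec.++ K
    max F′ d′ sub′ {v} v∈ with Vec.splitAt n F′
    ... | F₁ , K₁ , refl with view v
    ... | left i = ↑ˡ∈⁺ (maximal mF {F₁} (λ _ → ∈⊤) (diss-⊕ˡ d′) (λ p → ↑ˡ∈⁻ (sub′ (↑ˡ∈⁺ p))) (↑ˡ∈⁻ v∈))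
    ... | right i = ↑ʳ∈⁺ {F} (maximal mK {K₁} (λ _ → ∈⊤) (diss-⊕ʳ {F₁} d′) (λ p → ↑ʳ∈⁻ {F₁} (sub′ (↑ʳ∈⁺ {F} p))) (↑ʳ∈⁻ {F₁} v∈))

-- The two-element vertex sets of the 4-cycle, the same six that occur in `square-cover`.
pairs : List (Subset 4)
pairs = (true ∷ true ∷ false ∷ false ∷ []) ∷ (true ∷ false ∷ true ∷ false ∷ []) ∷ (true ∷ false ∷ false ∷ true ∷ [])
  ∷ (false ∷ true ∷ true ∷ false ∷ []) ∷ (false ∷ true ∷ false ∷ true ∷ []) ∷ (false ∷ false ∷ true ∷ true ∷ []) ∷ []

pairs-maximal : All (IsMaximalDissociation C4) pairs
pairs-maximal = toWitness {a? = All.all? (isMaximalDissociation? C4) pairs} _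

pairs-unique : Unique pairs
pairs-unique = toWitness {a? = AllPairs.allPairs? (λ x y → ¬? (Vec.≡-dec Bool._≟_ x y)) pairs} _

pair-choices : ∀ k → List (Subset (k * 4))
pair-choices zero = [] ∷ []
pair-choices (suc k) = cartesianProductWith Vec._++_ pairs (pair-choices k)

length-cartesianProductWith : ∀ {A B C : Set} (f : A → B → C) xs ys → length (cartesianProductWith f xs ys) ≡ length xs * length ys
length-cartesianProductWith f [] ys = refl
length-cartesianProductWith f (x ∷ xs) ys = trans (length-++ (map (f x) ys)) (cong₂ _+_ (length-map (f x) ys) (length-cartesianProductWith f xs ys))

length-pair-choices : ∀ k → length (pair-choices k) ≡ 6 ^ k
length-pair-choices zero = refl
length-pair-choices (suc k) = trans (length-cartesianProductWith Vec._++_ pairs (pair-choices k)) (cong (6 *_) (length-pair-choices k))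

pair-choices-unique : ∀ k → Unique (pair-choices k)
pair-choices-unique zero = [] ∷ []
pair-choices-unique (suc k) = Unique.cartesianProductWith⁺ Vec._++_ (λ {w} {x} → Vec.++-injective w x) pairs-unique (pair-choices-unique k)

pair-choices-maximal : ∀ k {F} → F ∈ˡ pair-choices k → MaxIn (C4s k) ⊤ F
pair-choices-maximal zero {[]} _ = record { sub = λ () ; diss = λ () ; maximal = λ { {[]} _ _ _ () } }
pair-choices-maximal (suc k) i with ∈-cartesianProductWith⁻ Vec._++_ pairs (pair-choices k) i
... | _ , _ , p∈ , q∈ , refl = maxIn-⊕ (maxIn⁺ C4 (All.lookup pairs-maximal p∈)) (pair-choices-maximal k q∈)

-- Transport along isomorphisms and the lower bound

module Transport {n m} {G : Graph n} {H : Graph m} (iso : G ≅ H) where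
  open _≅_ iso
  open Inverse (⤖⇒↔ bij) using (to; from; strictlyInverseˡ; strictlyInverseʳ)

  pull : Subset m → Subset n
  pull F = tabulate (lookup F ∘ to)

  push : Subset n → Subset m
  push F = tabulate (lookup F ∘ from)

  ∈-tabulate⁺ : ∀ {k l} {F : Subset l} (f : Fin k → Fin l) {v} → f v ∈ F → v ∈ tabulate (lookup F ∘ f)
  ∈-tabulate⁺ {F = F} f {v} p = Vec.lookup⇒[]= v _ (trans (Vec.lookup∘tabulate (lookup F ∘ f) v) (Vec.[]=⇒lookup p))

  ∈-tabulate⁻ : ∀ {k l} {F : Subset l} (f : Fin k → Fin l) {v} → v ∈ tabulate (lookup F ∘ f) → f v ∈ F
  ∈-tabulate⁻ {F = F} f {v} p = Vec.lookup⇒[]= (f v) F (trans (≡-sym (Vec.lookup∘tabulate (lookup F ∘ f) v)) (Vec.[]=⇒lookup p))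

  pull-injective : ∀ {F F′} → pull F ≡ pull F′ → F ≡ F′
  pull-injective {F} {F′} eq = ⊆-antisym (half eq) (half (≡-sym eq))
    where
    half : ∀ {A B} → pull A ≡ pull B → A ⊆ B
    half {A} {B} e {x} x∈ = subst (_∈ B) (strictlyInverseˡ x)
      (∈-tabulate⁻ to (subst (from x ∈_) e (∈-tabulate⁺ to (subst (_∈ A) (≡-sym (strictlyInverseˡ x)) x∈))))

  to-injective : ∀ {u v} → to u ≡ to v → u ≡ v
  to-injective {u} {v} eq = trans (≡-sym (strictlyInverseʳ u)) (trans (cong from eq) (strictlyInverseʳ v))

  from-injective : ∀ {u v} → from u ≡ from v → u ≡ v
  from-injective {u} {v} eq = trans (≡-sym (strictlyInverseˡ u)) (trans (cong to eq) (strictlyInverseˡ v))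

  preserve-from : ∀ u v → E H u v ≡ E G (from u) (from v)
  preserve-from u v = ≡-sym (trans (preserve (from u) (from v)) (cong₂ (E H) (strictlyInverseˡ u) (strictlyInverseˡ v)))

  -- A competitor in `G` is pushed to `H`, where the maximality of `F` applies.
  pull-maximal : ∀ {F} → MaxIn H ⊤ F → MaxIn G ⊤ (pull F)
  pull-maximal {F} mx = record
    { sub = λ _ → ∈⊤
    ; diss = λ {v} {u} {w} v∈ u∈ w∈ vu vw → to-injective (diss mx (∈-tabulate⁻ to v∈) (∈-tabulate⁻ to u∈) (∈-tabulate⁻ to w∈)
        (subst T (preserve v u) vu) (subst T (preserve v w) vw))
    ; maximal = λ {F′} _ d′ sub′ {v} v∈ → ∈-tabulate⁺ to (maximal mx {push F′} (λ _ → ∈⊤) (push-diss d′)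
        (λ {x} x∈ → ∈-tabulate⁺ from (sub′ (∈-tabulate⁺ to (subst (_∈ F) (≡-sym (strictlyInverseˡ x)) x∈))))
        (∈-tabulate⁺ from (subst (_∈ F′) (≡-sym (strictlyInverseʳ v)) v∈)))
    }
    where
    push-diss : ∀ {F′} → Dissociated G F′ → Dissociated H (push F′)
    push-diss d′ {v} {u} {w} v∈ u∈ w∈ vu vw = from-injective (d′ (∈-tabulate⁻ from v∈) (∈-tabulate⁻ from u∈) (∈-tabulate⁻ from w∈)
      (subst T (preserve-from v u) vu) (subst T (preserve-from v w) vw))

-- One inequality suffices: the opposite one holds for every triangle-free graph.
φ-lower-bound : ∀ {n} (G : Graph n) k → G ≅ C4s k → 6 ^ k ≤ φ G
φ-lower-bound G k iso = subst (_≤ φ G) (trans (length-map pull (pair-choices k)) (length-pair-choices k))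
  (countSubsets-≥ (isMaximalDissociation? G) (map pull (pair-choices k)) (Unique.map⁺ pull-injective (pair-choices-unique k)) sound)
  where
  open Transport iso
  sound : ∀ {F} → F ∈ˡ map pull (pair-choices k) → IsMaximalDissociation G F
  sound i with ∈-map⁻ pull i
  ... | _ , j , refl = maxIn⁻ G (pull-maximal (pair-choices-maximal k j))

-- From coverings to the bound on φ

module _ (d : ℕ) {f l c k : ℕ} (f≤l : f ≤ l) (size : (d * l) ^ 4 * 1 ≤ c ^ 4 * 6 ^ k) where

  private
    scaled : d ^ 4 * f ^ 4 ≤ c ^ 4 * 6 ^ k
    scaled = begin
      d ^ 4 * f ^ 4    ≤⟨ *-monoʳ-≤ (d ^ 4) (^-monoˡ-≤ 4 f≤l) ⟩
      d ^ 4 * l ^ 4    ≡⟨ ^4-* d l ⟨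
      (d * l) ^ 4      ≡⟨ *-identityʳ ((d * l) ^ 4) ⟨
      (d * l) ^ 4 * 1  ≤⟨ size ⟩
      c ^ 4 * 6 ^ k    ∎
      where open ≤-Reasoning

  size⇒≤ : .{{_ : NonZero (d ^ 4)}} → c ≤ d → f ^ 4 ≤ 6 ^ k
  size⇒≤ c≤d = *-cancelˡ-≤ (d ^ 4) (≤-trans scaled (*-monoˡ-≤ (6 ^ k) (^-monoˡ-≤ 4 c≤d)))

  size⇒< : c < d → f ^ 4 < 6 ^ k
  size⇒< c<d = *-cancelˡ-< (d ^ 4) (f ^ 4) (6 ^ k) (≤-<-trans scaled (*-monoˡ-< (6 ^ k) {{6^-nonZero {k}}} (^-monoˡ-< 4 c<d)))

theorem1p2 : (n : ℕ) (G : Graph n) → TriangleFree G →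
    (φ G ^ 4 ≤ 6 ^ n) × ((φ G ^ 4 ≡ 6 ^ n) ⇔ ((4 ∣ n) × (G ≅ C4s (n / 4))))
theorem1p2 n G triangle-free = upper , mk⇔ tight⇒≅ ≅⇒tight
  where
  open Verdicts G triangle-free
  open Decomposition G triangle-free
  V : Verdict ⊤
  V = verdict (suc ∣ ⊤ {n} ∣) ⊤ ≤-refl
  φ≤ : ∀ {c} (C : Covered (MaxIn G ⊤) c 0 ∣ ⊤ {n} ∣) → φ G ≤ length (Covered.list C)
  φ≤ C = countSubsets-≤ (isMaximalDissociation? G) (Covered.list C) (λ m → Covered.covers C (maxIn⁺ G m))
  upper : φ G ^ 4 ≤ 6 ^ n
  upper = subst (λ k → φ G ^ 4 ≤ 6 ^ k) (∣⊤∣≡n n) (size⇒≤ D {k = ∣ ⊤ {n} ∣} (φ≤ (verdict⇒cover V)) (Covered.size (verdict⇒cover V)) ≤-refl)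
  tight⇒≅ : φ G ^ 4 ≡ 6 ^ n → (4 ∣ n) × (G ≅ C4s (n / 4))
  tight⇒≅ eq with V
  -- A constant below 1 gives φ^4 < 6^n, against the assumed equality.
  ... | strict C = ⊥-elim (<⇒≢ (size⇒< D {c = 99900} {k = ∣ ⊤ {n} ∣} (φ≤ C) (Covered.size C) evaluated) (trans eq (cong (6 ^_) (≡-sym (∣⊤∣≡n n)))))
  ... | tight Ss _ = squares⇒≅ Ss
  ≅⇒tight : (4 ∣ n) × (G ≅ C4s (n / 4)) → φ G ^ 4 ≡ 6 ^ n
  ≅⇒tight (divides k refl , iso) = ≤-antisym upper (begin
    6 ^ (k * 4)   ≡⟨ ^-*-assoc 6 k 4 ⟨
    (6 ^ k) ^ 4   ≤⟨ ^-monoˡ-≤ 4 (φ-lower-bound G k (subst (λ l → G ≅ C4s l) (m*n/n≡m k 4) iso)) ⟩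
    φ G ^ 4       ∎)
    where open ≤-Reasoning
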